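{- For all $n\ge1$: (1) $R_n(1/2/3)=\{\sigma\in\Pi_n:\sigma\text{ has at most 2 blocks}\}$ and $\#R_n(1/2/3)=2^{n-1}$; (2) $R_n(123)=\{\sigma\in\Pi_n:\sigma\text{ is a matching}\}$ and $\#R_n(123)=\sum_{i\ge0}\binom n{2i}(2i)!!$; (3) $R_n(12/3)$ is the set of $\sigma\in\Pi_n$ for which there exists $k\in[0,n]$ such that $\sigma_{\le k}=1/2/\ldots/k$ and $\sigma_{>k}$ is layered with blocks $D_1,\ldots,D_t$ listed left to right satisfying $B(D_1)>B(D_2)>\cdots>B(D_t)$; and $\#R_n(12/3)=2^{n-1}$; (4) $R_n(1/23)=\{\sigma=C_1/\ldots/C_l\in\Pi_n\text{ (canonical order)}:\#C_i=1\text{ for all }i\ge2\}$ and $\#R_n(1/23)=2^{n-1}$; (5) $R_n(13/2)=\{\sigma\in\Pi_n:\sigma\text{ is layered}\}$ and $\#R_n(13/2)=2^{n-1}$.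
   Context: $[n]=\{1,\ldots,n\}$, $[a,b]=\{a,\ldots,b\}$; $\Pi_n$ is the set of partitions of $[n]$, written with slashes between blocks. A partition $\pi=B_1/\ldots/B_k$ is in canonical order if $\min B_1<\cdots<\min B_k$; for $S$ contained in a block of $\sigma$, $B(S)$ is the index of the block of $\sigma$ containing $S$ in canonical order. The restricted growth function of $\pi\in\Pi_n$ is $\rho(\pi)=a_1\ldots a_n$ with $a_i=B(\{i\})$. A sequence contains $r$ if some subsequence standardizes (order-preserving relabeling of values onto $1,2,\ldots$) to $r$. $\sigma$ R-contains $\pi$ if $\rho(\sigma)$ contains $\rho(\pi)$, otherwise R-avoids $\pi$; $R_n(\pi)$ is the set of $\sigma\in\Pi_n$ R-avoiding $\pi$. For $T\subseteq[n]$, $\sigma_T$ is the partition of $T$ with blocks the nonempty $C\cap T$, $C\in\sigma$; $\sigma_{\le k}=\sigma_{[k]}$, $\sigma_{>k}=\sigma_{[k+1,n]}$. A matching is a partition with all blocks of size at most 2; $(2i)!!=1\cdot3\cdots(2i-1)$, $(0)!!=1$. A partition (of a set of consecutive integers) is layered if all its blocks are intervals of consecutive integers. -}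

module Defs where

open import Level using (0ℓ)
open import Data.Bool.Base using (if_then_else_)
open import Data.Fin.Base as Fin using (Fin; zero; suc; toℕ)
open import Data.Fin.Patterns using (0F; 1F; 2F)
open import Data.Fin.Subset using (Subset; inside; outside; Nonempty; Empty; ⊤; ⋃; ⁅_⁆; ∣_∣; _∩_; _∪_)
  renaming (_∈_ to _∈ₛ_)
open import Data.Fin.Subset.Properties
  using (_∈?_; _⊆?_; nonempty?; ⊆-antisym; ∉⊥; ∈⊤; x∈⁅x⁆; x∈⁅y⁆⇒x≡y; x∈p∩q⁺; x∈p∩q⁻; x∈p∪q⁺; x∈p∪q⁻)
open import Data.List.Base
  using (List; []; _∷_; map; filter; length; drop; tabulate; allFin; deduplicate)
open import Data.List.Membership.Propositional using (_∈_; find; lose)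
open import Data.List.Membership.Propositional.Properties
  using (∈-map⁺; ∈-map⁻; ∈-filter⁺; ∈-filter⁻; ∈-allFin)
open import Data.List.Relation.Binary.BagAndSetEquality using (_∼[_]_; set)
open import Data.List.Relation.Binary.Sublist.Propositional using (_⊆_)
open import Data.List.Relation.Unary.All as All using (All; []; _∷_)
import Data.List.Relation.Unary.All.Properties as Allₚ
open import Data.List.Relation.Unary.AllPairs as AllPairs using (AllPairs; []; _∷_; allPairs?)
import Data.List.Relation.Unary.AllPairs.Properties as AllPairsₚ
open import Data.List.Relation.Unary.Any as Any using (Any; here; there)
open import Data.List.Relation.Unary.Unique.Propositional.Properties using (allFin⁺)
open import Data.Nat.Base using (ℕ; zero; suc; _+_; _*_; _≤_; _<_; _>_)
import Data.Nat.Properties as ℕ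
open import Data.Product.Base using (∃; ∃-syntax; _×_; _,_; proj₁; proj₂)
open import Data.Sum.Base using (inj₁; inj₂)
import Data.Vec.Base as Vec
open import Function.Base using (_∘_)
open import Function.Bundles using (Inverse)
open import Relation.Binary.Bundles using (Setoid)
import Relation.Binary.Construct.On as On
open import Relation.Binary.PropositionalEquality as ≡ using (_≡_; refl; sym; trans; subst)
open import Relation.Nullary using (¬_; does; contradiction)
open import Relation.Nullary.Decidable using (_×-dec_; ¬?; True; toWitness)
open import Relation.Unary using (Pred)

private variable
  m n : ℕ

-- The ground set [n] is Fin n; i : Fin n stands for the integer suc (toℕ i).

[_,_] : ℕ → ℕ → Subset n
[ a , b ] = Vec.tabulate λ i → does ((a ℕ.≤? suc (toℕ i)) ×-dec (suc (toℕ i) ℕ.≤? b))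

Disjoint : Subset n → Subset n → Set
Disjoint C D = Empty (C ∩ D)

-- The order of the list carries no meaning here: see _≋_.
record Partition {n : ℕ} (T : Subset n) : Set where
  field
    blocks   : List (Subset n)
    nonempty : All Nonempty blocks
    disjoint : AllPairs Disjoint blocks
    covers   : ⋃ blocks ≡ T

open Partition public

_≋_ : {T : Subset n} → Partition T → Partition T → Set
π ≋ π′ = blocks π ∼[ set ] blocks π′

-- Only meaningful for nonempty subsets (the empty subset of [n] gets n + 1).
min : Subset n → ℕ
min Vec.[]             = 1
min (inside  Vec.∷ _)  = 1
min (outside Vec.∷ S)  = suc (min S)

-- A partition of [n] is stored through its canonical listing, which is
-- unique; hence two elements of Π n are the same partition exactly when their
-- lists of blocks are equal (see #_is_).
record Π (n : ℕ) : Set where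
  field
    partition : Partition {n} ⊤
    canonical : AllPairs (λ C D → min C < min D) (blocks partition)

open Π public

blocksΠ : Π n → List (Subset n)
blocksΠ σ = blocks (partition σ)

-- 1-based position of the first listed block containing S; it is the only one
-- when S is nonempty and contained in a block, the case in which it is used.
index : List (Subset n) → Subset n → ℕ
index []       S = 1
index (C ∷ Cs) S = if does (S ⊆? C) then 1 else suc (index Cs S)

B : Π n → Subset n → ℕ
B σ S = index (blocksΠ σ) S

ρ : Π n → List ℕ
ρ σ = tabulate λ i → B σ ⁅ i ⁆

-- A value is relabelled by its rank among the distinct values of the sequence.
standardize : List ℕ → List ℕ
standardize s = map (λ v → length (filter (ℕ._≤? v) (deduplicate ℕ._≟_ s))) s

-- _⊆_ is the (not necessarily contiguous) subsequence relation on lists.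
_contains_ : List ℕ → List ℕ → Set
w contains r = ∃[ s ] s ⊆ w × standardize s ≡ r

_R-contains_ : Π n → Π m → Set
σ R-contains π = ρ σ contains ρ π

R : (n : ℕ) → Π m → Pred (Π n) 0ℓ
R n π σ = ¬ (σ R-contains π)

private
  ∈⋃⁺ : ∀ {x : Fin n} {Cs} → Any (x ∈ₛ_) Cs → x ∈ₛ ⋃ Cs
  ∈⋃⁺ (here p)  = x∈p∪q⁺ (inj₁ p)
  ∈⋃⁺ (there p) = x∈p∪q⁺ (inj₂ (∈⋃⁺ p))

  ∈⋃⁻ : ∀ {x : Fin n} Cs → x ∈ₛ ⋃ Cs → Any (x ∈ₛ_) Cs
  ∈⋃⁻ []       p = contradiction p ∉⊥
  ∈⋃⁻ (C ∷ Cs) p with x∈p∪q⁻ C (⋃ Cs) p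
  ... | inj₁ q = here q
  ... | inj₂ q = there (∈⋃⁻ Cs q)

-- σ_T: the blocks are the nonempty C ∩ T, not necessarily in canonical order.
_↾_ : Π n → (T : Subset n) → Partition T
_↾_ {n} σ T = record
  { blocks   = Ds
  ; nonempty = Allₚ.all-filter nonempty? (map (_∩ T) Cs)
  ; disjoint = AllPairsₚ.filter⁺ nonempty? (AllPairsₚ.map⁺ (AllPairs.map shrink (disjoint (partition σ))))
  ; covers   = ⊆-antisym ⊆T T⊆
  }
  where
  Cs Ds : List (Subset n)
  Cs = blocksΠ σ
  Ds = filter nonempty? (map (_∩ T) Cs)

  shrink : ∀ {C D} → Disjoint C D → Disjoint (C ∩ T) (D ∩ T)
  shrink {C} {D} e (x , x∈) =
    let p , q = x∈p∩q⁻ (C ∩ T) (D ∩ T) x∈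
    in e (x , x∈p∩q⁺ (proj₁ (x∈p∩q⁻ C T p) , proj₁ (x∈p∩q⁻ D T q)))

  ⊆T : ∀ {x} → x ∈ₛ ⋃ Ds → x ∈ₛ T
  ⊆T p with find (∈⋃⁻ Ds p)
  ... | D , D∈ , x∈D with ∈-map⁻ (_∩ T) (proj₁ (∈-filter⁻ nonempty? {xs = map (_∩ T) Cs} D∈))
  ... | C , _ , refl = proj₂ (x∈p∩q⁻ C T x∈D)

  T⊆ : ∀ {x} → x ∈ₛ T → x ∈ₛ ⋃ Ds
  T⊆ {x} x∈T with find (∈⋃⁻ Cs (subst (x ∈ₛ_) (sym (covers (partition σ))) ∈⊤))
  ... | C , C∈ , x∈C = ∈⋃⁺ (lose (∈-filter⁺ nonempty? (∈-map⁺ (_∩ T) C∈) (x , x∈C∩T)) x∈C∩T)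
    where x∈C∩T = x∈p∩q⁺ (x∈C , x∈T)

-- The partition of T into singletons; 1/2/…/k is singletons [ 1 , k ].
singletons : (T : Subset n) → Partition T
singletons {n} T = record
  { blocks   = map ⁅_⁆ xs
  ; nonempty = Allₚ.map⁺ (All.universal (λ x → x , x∈⁅x⁆ x) xs)
  ; disjoint = AllPairsₚ.map⁺ (AllPairs.map apart (AllPairsₚ.filter⁺ (_∈? T) (allFin⁺ n)))
  ; covers   = ⊆-antisym ⊆T T⊆
  }
  where
  xs : List (Fin n)
  xs = filter (_∈? T) (allFin n)

  apart : ∀ {x y : Fin n} → ¬ (x ≡ y) → Disjoint ⁅ x ⁆ ⁅ y ⁆
  apart {x} {y} x≢y (z , z∈) =
    let p , q = x∈p∩q⁻ ⁅ x ⁆ ⁅ y ⁆ z∈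
    in x≢y (trans (sym (x∈⁅y⁆⇒x≡y x p)) (x∈⁅y⁆⇒x≡y y q))

  ⊆T : ∀ {x} → x ∈ₛ ⋃ (map ⁅_⁆ xs) → x ∈ₛ T
  ⊆T p with find (∈⋃⁻ (map ⁅_⁆ xs) p)
  ... | D , D∈ , x∈D with ∈-map⁻ ⁅_⁆ D∈
  ... | y , y∈ , refl with x∈⁅y⁆⇒x≡y y x∈D
  ... | refl = proj₂ (∈-filter⁻ (_∈? T) {xs = allFin n} y∈)

  T⊆ : ∀ {x} → x ∈ₛ T → x ∈ₛ ⋃ (map ⁅_⁆ xs)
  T⊆ {x} x∈T = ∈⋃⁺ (lose (∈-map⁺ ⁅_⁆ (∈-filter⁺ (_∈? T) (∈-allFin x) x∈T)) (x∈⁅x⁆ x))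

Matching : Pred (Π n) 0ℓ
Matching σ = All (λ C → ∣ C ∣ ≤ 2) (blocksΠ σ)

Interval : Pred (Subset n) 0ℓ
Interval D = ∃[ a ] ∃[ b ] D ≡ [ a , b ]

Layered : {T : Subset n} → Pred (Partition T) 0ℓ
Layered π = All Interval (blocks π)

_leftOf_ : Subset n → Subset n → Set
D leftOf E = ∀ {i j} → i ∈ₛ D → j ∈ₛ E → i Fin.< j

AtMostTwoBlocks : Pred (Π n) 0ℓ
AtMostTwoBlocks σ = length (blocksΠ σ) ≤ 2

SingletonsThenDescendingLayers : Pred (Π n) 0ℓ
SingletonsThenDescendingLayers {n} σ =
  ∃[ k ] k ≤ n
    × (σ ↾ [ 1 , k ]) ≋ singletons [ 1 , k ]
    × Layered (σ ↾ [ suc k , n ])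
    × ∃[ Ds ] Ds ∼[ set ] blocks (σ ↾ [ suc k , n ])
        × AllPairs _leftOf_ Ds
        × AllPairs (λ D E → B σ D > B σ E) Ds

SingletonsAfterFirst : Pred (Π n) 0ℓ
SingletonsAfterFirst σ = All (λ C → ∣ C ∣ ≡ 1) (drop 1 (blocksΠ σ))

LayeredΠ : Pred (Π n) 0ℓ
LayeredΠ σ = Layered (partition σ)

ΠSetoid : Pred (Π n) 0ℓ → Setoid 0ℓ 0ℓ
ΠSetoid P = On.setoid {B = ∃ P} (≡.setoid (List (Subset _))) (blocksΠ ∘ proj₁)

#_is_ : Pred (Π n) 0ℓ → ℕ → Set
# P is c = Inverse (ΠSetoid P) (≡.setoid (Fin c))

-- [2 i ]!! is (2i)!! = 1 · 3 ⋯ (2i − 1), which is not the usual double factorial.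
[2_]!! : ℕ → ℕ
[2 zero  ]!! = 1
[2 suc i ]!! = [2 i ]!! * suc (2 * i)

private
  mkΠ₃ : (Cs : List (Subset 3)) →
         {True (All.all? nonempty? Cs)} →
         {True (allPairs? (λ C D → ¬? (nonempty? (C ∩ D))) Cs)} →
         {True (allPairs? (λ C D → min C ℕ.<? min D) Cs)} →
         ⋃ Cs ≡ ⊤ → Π 3
  mkΠ₃ Cs {ne} {dj} {cn} cov = record
    { partition = record
        { blocks = Cs ; nonempty = toWitness ne ; disjoint = toWitness dj ; covers = cov }
    ; canonical = toWitness cn
    }

-- The integers 1, 2, 3 are 0F, 1F, 2F.
π1/2/3 π123 π12/3 π1/23 π13/2 : Π 3
π1/2/3 = mkΠ₃ (⁅ 0F ⁆ ∷ ⁅ 1F ⁆ ∷ ⁅ 2F ⁆ ∷ []) refl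
π123   = mkΠ₃ (⊤ ∷ []) refl
π12/3  = mkΠ₃ ((⁅ 0F ⁆ ∪ ⁅ 1F ⁆) ∷ ⁅ 2F ⁆ ∷ []) refl
π1/23  = mkΠ₃ (⁅ 0F ⁆ ∷ (⁅ 1F ⁆ ∪ ⁅ 2F ⁆) ∷ []) refl
π13/2  = mkΠ₃ ((⁅ 0F ⁆ ∪ ⁅ 2F ⁆) ∷ ⁅ 1F ⁆ ∷ []) refl

_ : ρ π1/2/3 ≡ 1 ∷ 2 ∷ 3 ∷ []
_ = refl
_ : ρ π123 ≡ 1 ∷ 1 ∷ 1 ∷ []
_ = refl
_ : ρ π12/3 ≡ 1 ∷ 1 ∷ 2 ∷ []
_ = refl
_ : ρ π1/23 ≡ 1 ∷ 2 ∷ 2 ∷ []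
_ = refl
_ : ρ π13/2 ≡ 1 ∷ 2 ∷ 1 ∷ []
_ = refl
_ : standardize (5 ∷ 2 ∷ 5 ∷ 7 ∷ []) ≡ 2 ∷ 1 ∷ 2 ∷ 3 ∷ []
_ = refl

{-# OPTIONS --safe #-}

-- A partition σ is determined by its restricted growth function ρ σ, since its
-- blocks are the level sets of ρ σ, and every restricted growth function arises in
-- this way.  Both halves of each statement are therefore about words: the five
-- patterns have three letters, so avoidance is a condition on triples i < j < k of
-- positions, and it suffices to list the avoiding words without repetition.
--
-- For 123, 122 and 121 such a word starts with 1 and each further letter is one of
-- two; for 112 each word of length n yields two of length n + 1, by appending 1
-- or by prepending 1 and raising all other letters.  For 111, removing the first
-- block gives T (n + 2) = T (n + 1) + (n + 1) T n, a recurrence that Σ C(n, 2i) (2i)!!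
-- also satisfies by Pascal's rule and absorption.
module Submission where

open import Defs
open import Data.Bool.Base using (true; false)
open import Data.Fin.Base as Fin using (Fin; zero; suc; toℕ; fromℕ<)
open import Data.Fin.Properties using (toℕ-injective; toℕ-fromℕ<; toℕ<n)
open import Data.Fin.Subset using (Subset; inside; outside; Nonempty; ⋃; ⁅_⁆; _∩_; ∣_∣)
  renaming (_∈_ to _∈ₛ_; _⊆_ to _⊆ₛ_)
open import Data.Fin.Subset.Properties
  using (_⊆?_; nonempty?; ⊆-antisym; ⊆⊤; ∉⊥; ∈⊤; x∈⁅x⁆; x∈⁅y⁆⇒x≡y; x∈p∩q⁺; x∈p∩q⁻; x∈p∪q⁺; x∈p∪q⁻; p∩q⊆p)
  renaming (_∈?_ to _∈ₛ?_)
open import Data.List.Base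
  using (List; []; _∷_; _++_; map; filter; length; lookup; tabulate; allFin; concatMap; deduplicate; drop;
         upTo; applyUpTo; applyDownFrom; initLast; _∷ʳ′_)
  renaming ([_] to [_]ₗ)
open import Data.List.Membership.Propositional using (_∈_; _∉_; find; lose)
open import Data.List.Membership.Propositional.Properties
  using (∈-map⁺; ∈-map⁻; ∈-++⁺ˡ; ∈-++⁺ʳ; ∈-++⁻; ∈-∃++; ∈-concatMap⁺; ∈-concatMap⁻; ∈-filter⁺; ∈-filter⁻;
         ∈-deduplicate⁺; ∈-applyDownFrom⁺; ∈-applyDownFrom⁻; ∈-allFin; ∈-lookup; ∈-tabulate⁺)
open import Data.List.Properties
  using (∷-injective; ∷-injectiveˡ; ∷-injectiveʳ; ∷ʳ-injectiveˡ; length-map; length-++; length-tabulate;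
         ++-identityʳ; map-injective; map-upTo; filter-all; filter-accept; filter-reject; applyUpTo-∷ʳ;
         tabulate-cong; tabulate-lookup)
open import Data.List.Relation.Binary.BagAndSetEquality using (_∼[_]_; set)
open import Data.List.Relation.Binary.Disjoint.Propositional using () renaming (Disjoint to Disjointₗ)
open import Data.List.Relation.Binary.Sublist.Propositional as Sublist
  using (_⊆_; []; _∷_; _∷ʳ_; ⊆-refl; ⊆-trans; minimum; from∈; to∈)
open import Data.List.Relation.Binary.Sublist.Propositional.Properties as Sublistₚ
  using (++⁺; ++⁺ʳ; All-resp-⊆; ∷ˡ⁻; length-mono-≤; filter⁺)
open import Data.List.Relation.Unary.All as All using (All; []; _∷_)
import Data.List.Relation.Unary.All.Properties as Allₚ
open import Data.List.Relation.Unary.AllPairs as AllPairs using (AllPairs; []; _∷_)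
import Data.List.Relation.Unary.AllPairs.Properties as AllPairsₚ
open import Data.List.Relation.Unary.Any as Any using (here; there)
import Data.List.Relation.Unary.Any.Properties as Anyₚ
open import Data.List.Relation.Unary.Unique.Propositional using (Unique)
import Data.List.Relation.Unary.Unique.Propositional.Properties as Uniqueₚ
open import Data.Nat.Base using (ℕ; zero; suc; _+_; _*_; _^_; _∸_; _≤_; _<_; _>_; z≤n; s≤s; s≤s⁻¹)
open import Data.Nat.Combinatorics using (_C_; nCk+nC[k+1]≡[n+1]C[k+1]; k>n⇒nCk≡0; nC1≡n)
open import Data.Nat.ListAction using (sum)
open import Data.Nat.ListAction.Properties using (sum-++)
open import Data.Nat.Properties
  using (_≟_; _≤?_; <-cmp; suc-injective; ≤-refl; ≤-reflexive; ≤-trans; ≤-antisym; <-trans; <-irrefl; <-≤-trans;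
         ≤-<-trans; <⇒≤; <⇒≱; <⇒≢; ≰⇒>; ≮⇒≥; n<1+n; n≤1+n; m≤m+n; m≤n⇒m≤1+n; m≤n⇒m<n∨m≡n; +-comm; +-suc;
         +-identityʳ; *-comm; *-suc; *-zeroʳ; *-identityʳ; *-distribˡ-+)
open import Data.Nat.Tactic.RingSolver using (solve-∀)
open import Data.Product.Base using (∃; ∃-syntax; _×_; _,_; proj₁; proj₂)
open import Data.Sum.Base as Sum using (_⊎_; inj₁; inj₂)
open import Data.Vec.Base as Vec using (here; there)
import Data.Vec.Properties as Vecₚ
open import Function.Base using (_∘_)
open import Function.Bundles using (mk⇔; Equivalence)
open import Relation.Binary.Definitions using (tri<; tri≈; tri>)
open import Relation.Binary.PropositionalEquality
  using (_≡_; _≢_; _≗_; refl; sym; trans; cong; cong₂; subst; subst₂; module ≡-Reasoning)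
open import Relation.Nullary using (¬_; does; yes; no; contradiction)
open import Relation.Nullary.Decidable using (¬?; dec-true; dec-false; _×-dec_)
open import Relation.Unary using (Decidable; _≐_)
open import Data.List.Membership.DecPropositional _≟_ using (_∈?_)

open ≡-Reasoning

private variable
  a k m n u v x y z : ℕ
  s t w : List ℕ
  D S : Subset n
  Cs : List (Subset n)

-- Three-letter patterns

-- A count is a bijection with `Fin c` in which partitions are compared by their lists of blocks.
-- With a duplicate-free list of words, σ can simply be sent to the position of `ρ σ` in it. The
-- pattern 112 does not fit the scheme of two choices per letter: 11 extends only to 111, whereas 12
-- extends to 121, 122 and 123. The doubling becomes visible only when words are changed at both
-- ends. The descriptions of the five classes are not read off from the lists. They are proved for
-- the function `f i = B σ ⁅ i ⁆` and rest on two facts: every value from 1 to the number of blocks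
-- is attained, and before a position with value v every smaller positive value has occurred. The
-- second fact supplies the early letters that complete a forbidden pattern.

rank : List ℕ → ℕ → ℕ
rank D v = length (filter (_≤? v) D)

rank-mono-≤ : ∀ D {u v} → u ≤ v → rank D u ≤ rank D v
rank-mono-≤ D {u} {v} u≤v =
  length-mono-≤ (filter⁺ (_≤? u) (_≤? v) (λ { refl a≤u → ≤-trans a≤u u≤v }) (⊆-refl {x = D}))

-- The entry v itself is counted for v and not for u; if v were not in `D`, the two ranks could
-- agree.
rank-mono-< : ∀ {D u v} → v ∈ D → u < v → rank D u < rank D v
rank-mono-< {d ∷ D} {u} {v} (here refl) u<v
  rewrite dec-false (v ≤? u) (<⇒≱ u<v) | dec-true (v ≤? v) ≤-refl = s≤s (rank-mono-≤ D (<⇒≤ u<v))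
rank-mono-< {d ∷ D} {u} {v} (there v∈D) u<v with d ≤? u
... | yes d≤u rewrite dec-true (d ≤? v) (≤-trans d≤u (<⇒≤ u<v)) | dec-true (d ≤? u) d≤u = s≤s (rank-mono-< v∈D u<v)
... | no d≰u rewrite dec-false (d ≤? u) d≰u with d ≤? v
... | yes d≤v rewrite dec-true (d ≤? v) d≤v = ≤-trans (rank-mono-< v∈D u<v) (n≤1+n _)
... | no d≰v rewrite dec-false (d ≤? v) d≰v = rank-mono-< v∈D u<v

rank-cancel-< : ∀ D {u v} → rank D u < rank D v → u < v
rank-cancel-< D ru<rv = ≰⇒> λ v≤u → <⇒≱ ru<rv (rank-mono-≤ D v≤u)

rank-injective : ∀ {D u v} → u ∈ D → v ∈ D → rank D u ≡ rank D v → u ≡ v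
rank-injective {u = u} {v} u∈D v∈D eq with <-cmp u v
... | tri< u<v _ _ = contradiction eq (<⇒≢ (rank-mono-< v∈D u<v))
... | tri≈ _ u≡v _ = u≡v
... | tri> _ _ v<u = contradiction (sym eq) (<⇒≢ (rank-mono-< u∈D v<u))

Shape : Set₁
Shape = ℕ → ℕ → ℕ → Set

Occurs Avoids : Shape → List ℕ → Set
Occurs Q w = ∃[ x ] ∃[ y ] ∃[ z ] x ∷ y ∷ z ∷ [] ⊆ w × Q x y z
Avoids Q w = ∀ {x y z} → x ∷ y ∷ z ∷ [] ⊆ w → ¬ Q x y z

-- Trades standardization for comparisons of three letters, the form used by all later arguments
-- about words.
record _Characterises_ (Q : Shape) (r : List ℕ) : Set where
  field
    toShape   : ∀ {x y z} → standardize (x ∷ y ∷ z ∷ []) ≡ r → Q x y z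
    fromShape : ∀ {x y z} → Q x y z → standardize (x ∷ y ∷ z ∷ []) ≡ r

open _Characterises_

contains⇒occurs : ∀ {Q a b c w} → Q Characterises (a ∷ b ∷ c ∷ []) → w contains (a ∷ b ∷ c ∷ []) → Occurs Q w
contains⇒occurs Q-char (x ∷ y ∷ z ∷ [] , s⊆w , eq) = x , y , z , s⊆w , toShape Q-char eq

occurs⇒contains : ∀ {Q r w} → Q Characterises r → Occurs Q w → w contains r
occurs⇒contains Q-char (x , y , z , s⊆w , q) = x ∷ y ∷ z ∷ [] , s⊆w , fromShape Q-char q

S123 S111 S112 S122 S121 : Shape
S123 x y z = x < y × y < z
S111 x y z = x ≡ y × y ≡ z
S112 x y z = x ≡ y × y < z
S122 x y z = x < y × y ≡ z
S121 x y z = x ≡ z × x < y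

module _ {x y z a b c : ℕ} (eq : standardize (x ∷ y ∷ z ∷ []) ≡ a ∷ b ∷ c ∷ []) where
  private
    xyz letters : List ℕ
    xyz = x ∷ y ∷ z ∷ []
    letters = deduplicate _≟_ xyz

    rank-x : rank letters x ≡ a
    rank-x = proj₁ (∷-injective eq)

    rank-y : rank letters y ≡ b
    rank-y = proj₁ (∷-injective (proj₂ (∷-injective eq)))

    rank-z : rank letters z ≡ c
    rank-z = proj₁ (∷-injective (proj₂ (∷-injective (proj₂ (∷-injective eq)))))

    x∈ : x ∈ letters
    x∈ = ∈-deduplicate⁺ _≟_ {xs = xyz} (here refl)

    y∈ : y ∈ letters
    y∈ = ∈-deduplicate⁺ _≟_ {xs = xyz} (there (here refl))

    z∈ : z ∈ letters
    z∈ = ∈-deduplicate⁺ _≟_ {xs = xyz} (there (there (here refl)))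

  a<b⇒x<y : a < b → x < y
  a<b⇒x<y = rank-cancel-< letters ∘ subst₂ _<_ (sym rank-x) (sym rank-y)

  b<c⇒y<z : b < c → y < z
  b<c⇒y<z = rank-cancel-< letters ∘ subst₂ _<_ (sym rank-y) (sym rank-z)

  a≡b⇒x≡y : a ≡ b → x ≡ y
  a≡b⇒x≡y a≡b = rank-injective x∈ y∈ (trans rank-x (trans a≡b (sym rank-y)))

  b≡c⇒y≡z : b ≡ c → y ≡ z
  b≡c⇒y≡z b≡c = rank-injective y∈ z∈ (trans rank-y (trans b≡c (sym rank-z)))

  a≡c⇒x≡z : a ≡ c → x ≡ z
  a≡c⇒x≡z a≡c = rank-injective x∈ z∈ (trans rank-x (trans a≡c (sym rank-z)))

≤⇒≤? : ∀ {x y} → x ≤ y → does (x ≤? y) ≡ true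
≤⇒≤? {x} {y} = dec-true (x ≤? y)

<⇒≰? : ∀ {x y} → x < y → does (y ≤? x) ≡ false
<⇒≰? {x} {y} x<y = dec-false (y ≤? x) (<⇒≱ x<y)

≟-refl : ∀ x → does (x ≟ x) ≡ true
≟-refl x = dec-true (x ≟ x) refl

<⇒≟ : ∀ {x y} → x < y → does (x ≟ y) ≡ false
<⇒≟ {x} {y} x<y = dec-false (x ≟ y) (<⇒≢ x<y)

>⇒≟ : ∀ {x y} → x < y → does (y ≟ x) ≡ false
>⇒≟ {x} {y} x<y = dec-false (y ≟ x) (<⇒≢ x<y ∘ sym)

-- The rewrites follow the order in which the filters in standardize get stuck.
S123-char : S123 Characterises (1 ∷ 2 ∷ 3 ∷ [])
S123-char .toShape {x} eq = a<b⇒x<y eq (n<1+n 1) , b<c⇒y<z {x = x} eq (n<1+n 2)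
S123-char .fromShape {x} {y} {z} (x<y , y<z)
  rewrite <⇒≟ y<z | <⇒≟ x<y | <⇒≟ (<-trans x<y y<z)
        | ≤⇒≤? (≤-refl {x}) | <⇒≰? x<y | <⇒≰? (<-trans x<y y<z)
        | ≤⇒≤? (<⇒≤ x<y) | ≤⇒≤? (≤-refl {y}) | <⇒≰? y<z
        | ≤⇒≤? (<⇒≤ (<-trans x<y y<z)) | ≤⇒≤? (<⇒≤ y<z) | ≤⇒≤? (≤-refl {z}) = refl

S111-char : S111 Characterises (1 ∷ 1 ∷ 1 ∷ [])
S111-char .toShape {x} eq = a≡b⇒x≡y eq refl , b≡c⇒y≡z {x = x} eq refl
S111-char .fromShape {x} (refl , refl)
  rewrite ≟-refl x | ≤⇒≤? (≤-refl {x}) = refl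

S112-char : S112 Characterises (1 ∷ 1 ∷ 2 ∷ [])
S112-char .toShape {x} eq = a≡b⇒x≡y eq refl , b<c⇒y<z {x = x} eq (n<1+n 1)
S112-char .fromShape {x} {y} {z} (refl , x<z)
  rewrite <⇒≟ x<z | ≟-refl x | <⇒≟ x<z
        | ≤⇒≤? (≤-refl {x}) | <⇒≰? x<z | ≤⇒≤? (<⇒≤ x<z) | ≤⇒≤? (≤-refl {z}) = refl

S122-char : S122 Characterises (1 ∷ 2 ∷ 2 ∷ [])
S122-char .toShape {x} eq = a<b⇒x<y eq (n<1+n 1) , b≡c⇒y≡z {x = x} eq refl
S122-char .fromShape {x} {y} {z} (x<y , refl)
  rewrite ≟-refl y | <⇒≟ x<y
        | ≤⇒≤? (≤-refl {x}) | <⇒≰? x<y | ≤⇒≤? (<⇒≤ x<y) | ≤⇒≤? (≤-refl {y}) = refl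

S121-char : S121 Characterises (1 ∷ 2 ∷ 1 ∷ [])
S121-char .toShape {x} eq = a≡c⇒x≡z eq refl , a<b⇒x<y eq (n<1+n 1)
S121-char .fromShape {x} {y} {z} (refl , x<y)
  rewrite >⇒≟ x<y | <⇒≟ x<y | ≟-refl x
        | ≤⇒≤? (≤-refl {x}) | <⇒≰? x<y | ≤⇒≤? (<⇒≤ x<y) | ≤⇒≤? (≤-refl {y}) = refl

-- Restricted growth functions

-- RGF m w: the word w continues a restricted growth function with maximum m.
data RGF : ℕ → List ℕ → Set where
  []  : RGF m []
  old : 1 ≤ a → a ≤ m → RGF m w → RGF m (a ∷ w)
  new : RGF (suc m) w → RGF m (suc m ∷ w)

RGF-positive : RGF m w → All (1 ≤_) w
RGF-positive []            = []
RGF-positive (old 1≤a _ r) = 1≤a ∷ RGF-positive r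
RGF-positive (new r)       = s≤s z≤n ∷ RGF-positive r

-- Letters above m enter one at a time in increasing order, so z cannot occur before every v
-- strictly between m and z has.
RGF-predecessor : RGF m w → m < v → v < z → z ∈ w → v ∷ z ∷ [] ⊆ w
RGF-predecessor (old _ a≤m r) m<v v<z (here refl) = contradiction (<-trans m<v v<z) (<⇒≱ (s≤s a≤m))
RGF-predecessor (old _ _ r)   m<v v<z (there z∈)  = _ ∷ʳ RGF-predecessor r m<v v<z z∈
RGF-predecessor (new r)       m<v v<z (here refl) = contradiction v<z (<⇒≱ (s≤s m<v))
RGF-predecessor (new r)       m<v v<z (there z∈)  with m≤n⇒m<n∨m≡n m<v
... | inj₁ sm<v = _ ∷ʳ RGF-predecessor r sm<v v<z z∈
... | inj₂ refl = refl ∷ from∈ z∈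

RGF-++⁻ˡ : ∀ s → RGF m (s ++ t) → RGF m s
RGF-++⁻ˡ []      r               = []
RGF-++⁻ˡ (_ ∷ s) (old 1≤a a≤m r) = old 1≤a a≤m (RGF-++⁻ˡ s r)
RGF-++⁻ˡ (_ ∷ s) (new r)         = new (RGF-++⁻ˡ s r)

-- When the maximum is at least 1, a further 1 is an old letter and leaves the maximum alone, so it
-- can be put in or taken out anywhere.
RGF-insert-1 : ∀ s → 1 ≤ m → RGF m (s ++ t) → RGF m (s ++ 1 ∷ t)
RGF-insert-1 []      1≤m r               = old ≤-refl 1≤m r
RGF-insert-1 (_ ∷ s) 1≤m (old 1≤a a≤m r) = old 1≤a a≤m (RGF-insert-1 s 1≤m r)
RGF-insert-1 (_ ∷ s) 1≤m (new r)         = new (RGF-insert-1 s (s≤s z≤n) r)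

RGF-remove-1 : ∀ s → 1 ≤ m → RGF m (s ++ 1 ∷ t) → RGF m (s ++ t)
RGF-remove-1 []      (s≤s _) (old _ _ r)   = r
RGF-remove-1 (_ ∷ s) 1≤m (old 1≤a a≤m r) = old 1≤a a≤m (RGF-remove-1 s 1≤m r)
RGF-remove-1 (_ ∷ s) 1≤m (new r)         = new (RGF-remove-1 s (s≤s z≤n) r)

RGF-map-suc⁺ : RGF m w → RGF (suc m) (map suc w)
RGF-map-suc⁺ []              = []
RGF-map-suc⁺ (old 1≤a a≤m r) = old (m≤n⇒m≤1+n 1≤a) (s≤s a≤m) (RGF-map-suc⁺ r)
RGF-map-suc⁺ (new r)         = new (RGF-map-suc⁺ r)

-- An old letter is positive and not 1, and a new one exceeds `suc m`; so all letters are at least 2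
-- and can be lowered.
RGF-map-suc⁻ : RGF (suc m) w → 1 ∉ w → ∃[ t ] w ≡ map suc t × RGF m t
RGF-map-suc⁻ []                                    _  = [] , refl , []
RGF-map-suc⁻ (old {a = suc zero} _ _ r)            1∉ = contradiction (here refl) 1∉
RGF-map-suc⁻ (old {a = suc (suc a)} _ (s≤s a≤m) r) 1∉ with RGF-map-suc⁻ r (1∉ ∘ there)
... | t , refl , r′ = suc a ∷ t , refl , old (s≤s z≤n) a≤m r′
RGF-map-suc⁻ (new r)                               1∉ with RGF-map-suc⁻ r (1∉ ∘ there)
... | t , refl , r′ = _ , refl , new r′

1∉map-suc : All (1 ≤_) w → 1 ∉ map suc w
1∉map-suc pos 1∈ with ∈-map⁻ suc 1∈
... | zero , 0∈ , refl = contradiction (All.lookup pos 0∈) λ ()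

Avoids-⊆ : ∀ {Q} → s ⊆ t → Avoids Q t → Avoids Q s
Avoids-⊆ s⊆t av p = av (⊆-trans p s⊆t)

⊆-map⁻ : ∀ (f : ℕ → ℕ) {s w} → s ⊆ map f w → ∃[ t ] s ≡ map f t × t ⊆ w
⊆-map⁻ f {w = []}    []       = [] , refl , []
⊆-map⁻ f {w = _ ∷ _} (_ ∷ʳ p) with ⊆-map⁻ f p
... | t , refl , t⊆w = t , refl , _ ∷ʳ t⊆w
⊆-map⁻ f {w = b ∷ _} (refl ∷ p) with ⊆-map⁻ f p
... | t , refl , t⊆w = b ∷ t , refl , refl ∷ t⊆w

Avoids-map : ∀ {Q} {f : ℕ → ℕ} → (∀ {x y z} → Q (f x) (f y) (f z) → Q x y z) → Avoids Q w → Avoids Q (map f w)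
Avoids-map {f = f} Q-reflect av p q with ⊆-map⁻ f p
... | _ ∷ _ ∷ _ ∷ [] , refl , p′ = av p′ (Q-reflect q)

Avoids-map⁻ : ∀ {Q} {f : ℕ → ℕ} → (∀ {x y z} → Q x y z → Q (f x) (f y) (f z)) → Avoids Q (map f w) → Avoids Q w
Avoids-map⁻ {f = f} Q-resp av p q = av (Sublistₚ.map⁺ f p) (Q-resp q)

-- The positions in such a list become the elements of `Fin` in `#R`.
record Lists (P : List ℕ → Set) (L : List (List ℕ)) : Set where
  field
    unique   : Unique L
    sound    : ∀ {w} → w ∈ L → P w
    complete : ∀ {w} → P w → w ∈ L

open Lists

record AvoidingRGF (Q : Shape) (n : ℕ) (w : List ℕ) : Set where
  constructor mk
  field
    rgf    : RGF 0 w
    avoids : Avoids Q w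
    len    : length w ≡ n

open AvoidingRGF

-- At each step there is a choice between two letters, an old one (lo) and, for
-- the patterns 122 and 121, a new maximum (hi); the state m is then the current
-- maximum minus 1.
module Walks (lo hi : ℕ → ℕ) where

  data Walk : ℕ → List ℕ → Set where
    []   : Walk m []
    low  : Walk m w → Walk m (lo m ∷ w)
    high : Walk (suc m) w → Walk m (hi m ∷ w)

  walks : ℕ → ℕ → List (List ℕ)
  walks m zero    = [] ∷ []
  walks m (suc k) = map (lo m ∷_) (walks m k) ++ map (hi m ∷_) (walks (suc m) k)

  length-walks : ∀ m k → length (walks m k) ≡ 2 ^ k
  length-walks m zero    = refl
  length-walks m (suc k) = trans (length-++ (map _ (walks m k)))
    (cong₂ _+_ (trans (length-map _ (walks m k)) (length-walks m k))
               (trans (trans (length-map _ (walks (suc m) k)) (length-walks (suc m) k)) (sym (+-identityʳ _))))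

  length-1∷walks : ∀ k → length (map (1 ∷_) (walks 0 k)) ≡ 2 ^ k
  length-1∷walks k = trans (length-map (1 ∷_) (walks 0 k)) (length-walks 0 k)

  ∈-walks⁺ : Walk m w → w ∈ walks m (length w)
  ∈-walks⁺ []       = here refl
  ∈-walks⁺ (low p)  = ∈-++⁺ˡ (∈-map⁺ _ (∈-walks⁺ p))
  ∈-walks⁺ {m = m} {w = _ ∷ w} (high p) = ∈-++⁺ʳ (map _ (walks m (length w))) (∈-map⁺ _ (∈-walks⁺ p))

  ∈-walks⁻ : ∀ k → w ∈ walks m k → Walk m w × length w ≡ k
  ∈-walks⁻ zero    (here refl) = [] , refl
  ∈-walks⁻ {m = m} (suc k) w∈ with ∈-++⁻ (map (lo m ∷_) (walks m k)) w∈
  ... | inj₁ p with ∈-map⁻ (lo m ∷_) p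
  ... | _ , q , refl with ∈-walks⁻ k q
  ... | walk , refl = low walk , refl
  ∈-walks⁻ {m = m} (suc k) w∈ | inj₂ p with ∈-map⁻ (hi m ∷_) p
  ... | _ , q , refl with ∈-walks⁻ k q
  ... | walk , refl = high walk , refl

  module _ (lo≢hi : ∀ m → lo m ≢ hi m) where

    walks-unique : ∀ m k → Unique (walks m k)
    walks-unique m zero    = [] ∷ []
    walks-unique m (suc k) = Uniqueₚ.++⁺
      (Uniqueₚ.map⁺ ∷-injectiveʳ (walks-unique m k))
      (Uniqueₚ.map⁺ ∷-injectiveʳ (walks-unique (suc m) k))
      λ (p , q) → let _ , _ , eq = ∈-map⁻ _ p ; _ , _ , eq′ = ∈-map⁻ _ q
                  in lo≢hi m (∷-injectiveˡ (trans (sym eq) eq′))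

    walks-list : ∀ {Q} → (∀ {w} → Walk 0 w → RGF 1 w × Avoids Q (1 ∷ w)) →
                 (∀ {w} → RGF 1 w → Avoids Q (1 ∷ w) → Walk 0 w) →
                 ∀ k → Lists (AvoidingRGF Q (suc k)) (map (1 ∷_) (walks 0 k))
    walks-list s c k .unique = Uniqueₚ.map⁺ ∷-injectiveʳ (walks-unique 0 k)
    walks-list s c k .sound w∈ with ∈-map⁻ (1 ∷_) w∈
    ... | _ , p , refl with ∈-walks⁻ k p
    ... | walk , refl = mk (new (proj₁ (s walk))) (proj₂ (s walk)) refl
    -- Under maximum 0 there is no old letter, so the word starts with a new 1.
    walks-list s c k .complete (mk (old (s≤s _) () _) _ _)
    walks-list s c k .complete (mk (new r) av refl) = ∈-map⁺ (1 ∷_) (∈-walks⁺ (c r av))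

module Walks123 where
  open Walks (λ _ → 1) (λ _ → 2) public

  -- Separate from `walk⇒RGF₁` because the first 2 is a new maximum and every later 2 an old letter.
  walk⇒RGF₂ : Walk m w → RGF 2 w
  walk⇒RGF₂ []       = []
  walk⇒RGF₂ (low p)  = old (s≤s z≤n) (s≤s z≤n) (walk⇒RGF₂ p)
  walk⇒RGF₂ (high p) = old (s≤s z≤n) (s≤s (s≤s z≤n)) (walk⇒RGF₂ p)

  walk⇒RGF₁ : Walk m w → RGF 1 w
  walk⇒RGF₁ []       = []
  walk⇒RGF₁ (low p)  = old (s≤s z≤n) (s≤s z≤n) (walk⇒RGF₁ p)
  walk⇒RGF₁ (high p) = new (walk⇒RGF₂ p)

  walk-≤2 : Walk m w → All (_≤ 2) w
  walk-≤2 []       = []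
  walk-≤2 (low p)  = s≤s z≤n ∷ walk-≤2 p
  walk-≤2 (high p) = s≤s (s≤s z≤n) ∷ walk-≤2 p

  letters⇒walk : All (1 ≤_) w → All (_≤ 2) w → Walk m w
  letters⇒walk [] [] = []
  letters⇒walk {w = suc zero ∷ _}          (_ ∷ p) (_ ∷ q)           = low (letters⇒walk p q)
  letters⇒walk {w = suc (suc zero) ∷ _}    (_ ∷ p) (_ ∷ q)           = high (letters⇒walk p q)
  letters⇒walk {w = suc (suc (suc _)) ∷ _} (_ ∷ p) (s≤s (s≤s ()) ∷ q)

  list123 : ∀ k → Lists (AvoidingRGF S123 (suc k)) (map (1 ∷_) (walks 0 k))
  list123 = walks-list (λ _ ()) walk⇒avoiding avoiding⇒walk
    where
    walk⇒avoiding : Walk 0 w → RGF 1 w × Avoids S123 (1 ∷ w)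
    walk⇒avoiding walk = walk⇒RGF₁ walk , λ p (x<y , y<z) →
      let x≥1 = All.head (All-resp-⊆ p (RGF-positive (new {0} (walk⇒RGF₁ walk))))
          z≤2 = All.head (All-resp-⊆ (∷ˡ⁻ (∷ˡ⁻ p)) (s≤s z≤n ∷ walk-≤2 walk))
      in <⇒≱ (≤-<-trans (≤-<-trans x≥1 x<y) y<z) z≤2
    avoiding⇒walk : RGF 1 w → Avoids S123 (1 ∷ w) → Walk 0 w
    -- A letter z above 2 has a 2 before it, which together with the initial 1 gives 1 2 z.
    avoiding⇒walk r av = letters⇒walk (RGF-positive r) (All.tabulate λ {z} z∈ → ≮⇒≥ λ 2<z →
      av (refl ∷ RGF-predecessor r ≤-refl 2<z z∈) (≤-refl , 2<z))

module Walks122 where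
  open Walks (λ _ → 1) (λ m → suc (suc m)) public

  walk⇒RGF : Walk m w → RGF (suc m) w
  walk⇒RGF []       = []
  walk⇒RGF (low p)  = old (s≤s z≤n) (s≤s z≤n) (walk⇒RGF p)
  walk⇒RGF (high p) = new (walk⇒RGF p)

  walk-letters : Walk m w → All (λ a → a ≡ 1 ⊎ suc m < a) w
  walk-letters []       = []
  walk-letters (low p)  = inj₁ refl ∷ walk-letters p
  walk-letters (high p) = inj₂ ≤-refl ∷ All.map (λ { (inj₁ e) → inj₁ e ; (inj₂ l) → inj₂ (<⇒≤ l) }) (walk-letters p)

  -- A `high` letter is a new maximum, and the letters after it are 1 or larger still, so only 1 can
  -- recur.
  walk-repeat : Walk m w → y ∷ y ∷ [] ⊆ w → y ≡ 1
  walk-repeat (low p)  (_ ∷ʳ q)   = walk-repeat p q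
  walk-repeat (low p)  (refl ∷ q) = refl
  walk-repeat (high p) (_ ∷ʳ q)   = walk-repeat p q
  walk-repeat (high p) (refl ∷ q) with All.lookup (walk-letters p) (to∈ q)
  ... | inj₂ l = contradiction l (<-irrefl refl)

  -- A repeated letter other than 1 would complete a 122 with the initial 1, so
  -- letters between 2 and the current maximum are excluded from the rest.
  build : RGF (suc m) w → Avoids S122 (1 ∷ w) → (∀ {a} → 1 < a → a ≤ suc m → a ∉ w) → Walk m w
  build [] _ _ = []
  build (old {a = suc zero} _ _ r) av h =
    low (build r (Avoids-⊆ (refl ∷ (_ ∷ʳ ⊆-refl)) av) λ p q → h p q ∘ there)
  build (old {a = suc (suc a)} _ a≤m r) av h = contradiction (here refl) (h (s≤s (s≤s z≤n)) a≤m)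
  build (new r) av h =
    high (build r (Avoids-⊆ (refl ∷ (_ ∷ʳ ⊆-refl)) av) λ {a} 1<a a≤m a∈ → fresh 1<a (m≤n⇒m<n∨m≡n a≤m) a∈)
    where
    fresh : ∀ {a} → 1 < a → _ → a ∉ _
    fresh 1<a (inj₁ l)    a∈ = h 1<a (s≤s⁻¹ l) (there a∈)
    fresh 1<a (inj₂ refl) a∈ = av (refl ∷ refl ∷ from∈ a∈) (1<a , refl)

  list122 : ∀ k → Lists (AvoidingRGF S122 (suc k)) (map (1 ∷_) (walks 0 k))
  list122 = walks-list (λ _ ()) walk⇒avoiding λ r av → build r av λ p q → contradiction q (<⇒≱ p)
    where
    walk⇒avoiding : Walk 0 w → RGF 1 w × Avoids S122 (1 ∷ w)
    walk⇒avoiding {w} walk = walk⇒RGF walk , λ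
      { (_ ∷ʳ p) (x<y , refl) → bad (_ ∷ʳ p) x<y (∷ˡ⁻ p)
      ; (e ∷ p) (x<y , refl) → bad (e ∷ p) x<y p }
      where
      bad : x ∷ t ⊆ 1 ∷ w → x < y → ¬ (y ∷ y ∷ [] ⊆ w)
      bad p x<y q with walk-repeat walk q
      ... | refl = <⇒≱ x<y (All.head (All-resp-⊆ p (RGF-positive (new {0} (walk⇒RGF walk)))))

module Walks121 where
  open Walks suc (λ m → suc (suc m)) public

  walk⇒RGF : Walk m w → RGF (suc m) w
  walk⇒RGF []       = []
  walk⇒RGF (low p)  = old (s≤s z≤n) ≤-refl (walk⇒RGF p)
  walk⇒RGF (high p) = new (walk⇒RGF p)

  walk-≥ : Walk m w → All (suc m ≤_) w
  walk-≥ []       = []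
  walk-≥ (low p)  = ≤-refl ∷ walk-≥ p
  walk-≥ (high p) = n≤1+n _ ∷ All.map <⇒≤ (walk-≥ p)

  -- Each choice repeats or raises the last letter, whereas a 121 needs a descent.
  walk-sorted : Walk m w → AllPairs _≤_ (suc m ∷ w)
  walk-sorted []       = [] ∷ []
  walk-sorted (low p)  = walk-≥ (low p) ∷ walk-sorted p
  walk-sorted (high p) = walk-≥ (high p) ∷ walk-sorted p

  -- Going back to a letter below the current maximum suc m completes a 121.
  build : RGF (suc m) w → Avoids S121 (suc m ∷ w) → (∀ {a} → a ≤ m → a ∉ w) → Walk m w
  build [] _ _ = []
  build (old _ a≤m r) av h with m≤n⇒m<n∨m≡n a≤m
  ... | inj₁ a<m = contradiction (here refl) (h (s≤s⁻¹ a<m))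
  ... | inj₂ refl = low (build r (Avoids-⊆ (refl ∷ (_ ∷ʳ ⊆-refl)) av) λ p → h p ∘ there)
  build (new r) av h = high (build r (Avoids-⊆ (_ ∷ʳ ⊆-refl) av) λ a≤m a∈ → fresh (m≤n⇒m<n∨m≡n a≤m) a∈)
    where
    fresh : ∀ {a} → _ → a ∉ _
    fresh (inj₁ l)    a∈ = h (s≤s⁻¹ l) (there a∈)
    fresh (inj₂ refl) a∈ = av (refl ∷ refl ∷ from∈ a∈) (refl , ≤-refl)

  ⊆-sorted : AllPairs _≤_ w → x ∷ y ∷ z ∷ [] ⊆ w → y ≤ z
  ⊆-sorted (_ ∷ s) (_ ∷ʳ p) = ⊆-sorted s p
  ⊆-sorted (_ ∷ s) (_ ∷ p)  = go s p
    where
    go : AllPairs _≤_ w → y ∷ z ∷ [] ⊆ w → y ≤ z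
    go (_ ∷ s) (_ ∷ʳ p)   = go s p
    go (l ∷ _) (refl ∷ p) = All.lookup l (to∈ p)

  list121 : ∀ k → Lists (AvoidingRGF S121 (suc k)) (map (1 ∷_) (walks 0 k))
  list121 = walks-list (λ _ ()) (λ walk → walk⇒RGF walk , λ { p (refl , x<y) → <⇒≱ x<y (⊆-sorted (walk-sorted walk) p) })
    λ r av → build r av λ { z≤n 0∈ → contradiction (All.lookup (RGF-positive r) 0∈) λ () }

-- Words avoiding 112 and 111

-- On partitions: a new first element forming a singleton block.
grow : List ℕ → List ℕ
grow w = 1 ∷ map suc w

grow-injective : grow s ≡ grow t → s ≡ t
grow-injective = map-injective suc-injective ∘ ∷-injectiveʳ

grow-RGF : RGF 0 w → RGF 0 (grow w)
grow-RGF r = new (RGF-map-suc⁺ r)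

⊆-snoc⁻ : ∀ s {w} → s ++ [ z ]ₗ ⊆ w ++ [ a ]ₗ → s ++ [ z ]ₗ ⊆ w ⊎ z ≡ a
⊆-snoc⁻ []          {[]}    (refl ∷ _) = inj₂ refl
⊆-snoc⁻ (_ ∷ [])    {[]}    (_ ∷ ())
⊆-snoc⁻ (_ ∷ _ ∷ _) {[]}    (_ ∷ ())
⊆-snoc⁻ s           {b ∷ w} (_ ∷ʳ p)   = Sum.map₁ (b ∷ʳ_) (⊆-snoc⁻ s p)
⊆-snoc⁻ []          {b ∷ w} (refl ∷ p) = inj₁ (refl ∷ minimum w)
⊆-snoc⁻ (c ∷ s)     {b ∷ w} (refl ∷ p) = Sum.map₁ (refl ∷_) (⊆-snoc⁻ s p)

-- If a word 1 … avoiding 112 has a second 1, every later letter is 1, so the word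
-- ends in 1; otherwise deleting the first letter and lowering the others undoes
-- grow.  Hence there are two constructions at each length; words112 k has words of
-- length k + 1.
words112 : ℕ → List (List ℕ)
words112 zero    = [ [ 1 ]ₗ ]ₗ
words112 (suc k) = map (_++ [ 1 ]ₗ) (words112 k) ++ map grow (words112 k)

length-words112 : ∀ k → length (words112 k) ≡ 2 ^ k
length-words112 zero    = refl
length-words112 (suc k) = trans (length-++ (map _ (words112 k)))
  (cong₂ _+_ (trans (length-map _ (words112 k)) (length-words112 k))
             (trans (trans (length-map _ (words112 k)) (length-words112 k)) (sym (+-identityʳ _))))

module _ where
  private
    Good : ℕ → List ℕ → Set
    Good k = AvoidingRGF S112 (suc k)

    snoc-good : Good k w → Good (suc k) (w ++ [ 1 ]ₗ)
    snoc-good (mk [] _ ())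
    snoc-good (mk (old (s≤s _) () _) _ _)
    snoc-good {w = w@(_ ∷ w′)} (mk (new r) av len) = mk
      (new (append w′ (s≤s z≤n) r))
      (λ { {x} {y} {z} p (refl , x<z) → avoid p x<z })
      (cong suc (trans (length-++ w′) (trans (+-comm _ 1) len)))
      where
      append : ∀ t → 1 ≤ m → RGF m t → RGF m (t ++ [ 1 ]ₗ)
      append t 1≤m r = RGF-insert-1 t 1≤m (subst (RGF _) (sym (++-identityʳ t)) r)
      avoid : x ∷ x ∷ z ∷ [] ⊆ w ++ [ 1 ]ₗ → ¬ (x < z)
      avoid {x} p x<z with ⊆-snoc⁻ (x ∷ x ∷ []) p
      ... | inj₁ q    = av q (refl , x<z)
      -- The appended 1 would be the largest letter of the pattern, but x is at least 1.
      ... | inj₂ refl = <⇒≱ x<z (All.head (All-resp-⊆ p (RGF-positive (new (append w′ (s≤s z≤n) r)))))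

    -- The prepended 1 is the only 1, so it cannot be the repeated letter; any 112 would lie among
    -- the raised letters and come from w.
    grow-good : Good k w → Good (suc k) (grow w)
    grow-good {w = w} (mk r av len) = mk (grow-RGF r)
      (λ { {x} {y} {z} p (refl , x<z) → avoid p x<z }) (cong suc (trans (length-map suc w) len))
      where
      avoid : x ∷ x ∷ z ∷ [] ⊆ grow w → ¬ (x < z)
      avoid (_ ∷ʳ p)   x<z = Avoids-map {Q = S112} (λ { (refl , l) → refl , s≤s⁻¹ l }) av p (refl , x<z)
      avoid (refl ∷ p) x<z = 1∉map-suc (RGF-positive r) (Sublist.lookup p (here refl))

    listed⇒good : ∀ k → w ∈ words112 k → Good k w
    listed⇒good zero    (here refl) = mk (new []) (λ { (_ ∷ ()) ; (_ ∷ʳ ()) }) refl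
    listed⇒good (suc k) w∈ with ∈-++⁻ (map (_++ [ 1 ]ₗ) (words112 k)) w∈
    ... | inj₁ p with ∈-map⁻ (_++ [ 1 ]ₗ) p
    ... | _ , q , refl = snoc-good (listed⇒good k q)
    listed⇒good (suc k) w∈ | inj₂ p with ∈-map⁻ grow p
    ... | _ , q , refl = grow-good (listed⇒good k q)

    good⇒listed : ∀ k → Good k w → w ∈ words112 k
    good⇒listed _       (mk (old (s≤s _) () _) _ _)
    good⇒listed zero    (mk (new []) _ refl) = here refl
    good⇒listed (suc k) (mk (new {w = w} r) av len) with 1 ∈? w
    ... | no 1∉ with RGF-map-suc⁻ r 1∉
    ... | t , refl , r′ = ∈-++⁺ʳ (map (_++ [ 1 ]ₗ) (words112 k)) (∈-map⁺ grow (good⇒listed k (mk r′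
          (Avoids-map⁻ {Q = S112} (λ { (refl , l) → refl , s≤s l }) (Avoids-⊆ {Q = S112} (1 ∷ʳ ⊆-refl) av))
          (trans (sym (length-map suc t)) (suc-injective len)))))
    good⇒listed (suc k) (mk (new {w = w} r) av len) | yes 1∈ with initLast w
    ... | t ∷ʳ′ b with last-1
      where
      last-1 : b ≡ 1
      last-1 with ∈-++⁻ t 1∈
      ... | inj₂ (here refl) = refl
      ... | inj₁ 1∈t = ≤-antisym
        (≮⇒≥ λ 1<b → av (refl ∷ ++⁺ (from∈ 1∈t) ⊆-refl) (refl , 1<b))
        (All.lookup (RGF-positive r) (∈-++⁺ʳ t (here refl)))
    ... | refl = ∈-++⁺ˡ (∈-map⁺ (_++ [ 1 ]ₗ) (good⇒listed k (mk (new (RGF-++⁻ˡ t r))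
          (Avoids-⊆ {Q = S112} (++⁺ʳ [ 1 ]ₗ ⊆-refl) av)
          (suc-injective (trans (cong suc (trans (+-comm 1 _) (sym (length-++ t)))) len)))))

    -- The two constructions never give the same word: appending leaves a 1 behind the first letter,
    -- `grow` does not.
    words-unique : ∀ k → Unique (words112 k)
    words-unique zero    = [] ∷ []
    words-unique (suc k) = Uniqueₚ.++⁺
      (Uniqueₚ.map⁺ (λ {s} {t} → ∷ʳ-injectiveˡ s t) (words-unique k))
      (Uniqueₚ.map⁺ grow-injective (words-unique k))
      λ (p , q) → let s , s∈ , eq = ∈-map⁻ _ p ; t , t∈ , eq′ = ∈-map⁻ _ q
                  in ends s t (listed⇒good k t∈) (trans (sym eq) eq′)
      where
      ends : ∀ s t → Good k t → s ++ [ 1 ]ₗ ≢ grow t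
      -- The word `[ 1 ]ₗ` has both forms, but it grows from the empty word, which has the wrong
      -- length.
      ends []      []      (mk _ _ ()) _
      ends (_ ∷ s) t (mk r _ _) eq =
        1∉map-suc (RGF-positive r) (subst (1 ∈_) (∷-injectiveʳ eq) (∈-++⁺ʳ s (here refl)))

  list112 : ∀ k → Lists (AvoidingRGF S112 (suc k)) (words112 k)
  list112 k = record { unique = words-unique k ; sound = listed⇒good k ; complete = good⇒listed k }

-- Inserting a letter, and the words avoiding 111

insertions : ℕ → List ℕ → List (List ℕ)
insertions x []       = [ [ x ]ₗ ]ₗ
insertions x (y ∷ ys) = (x ∷ y ∷ ys) ∷ map (y ∷_) (insertions x ys)

length-insertions : ∀ x s → length (insertions x s) ≡ suc (length s)
length-insertions x []      = refl
length-insertions x (y ∷ s) = cong suc (trans (length-map _ (insertions x s)) (length-insertions x s))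

∈-insertions⁺ : ∀ s t → s ++ x ∷ t ∈ insertions x (s ++ t)
∈-insertions⁺ []      []      = here refl
∈-insertions⁺ []      (_ ∷ _) = here refl
∈-insertions⁺ (a ∷ s) t       = there (∈-map⁺ _ (∈-insertions⁺ s t))

∈-insertions⁻ : ∀ w → t ∈ insertions x w → ∃[ u ] ∃[ v ] w ≡ u ++ v × t ≡ u ++ x ∷ v
∈-insertions⁻ []      (here refl) = [] , [] , refl , refl
∈-insertions⁻ (a ∷ w) (here refl) = [] , a ∷ w , refl , refl
∈-insertions⁻ (a ∷ w) (there p) with ∈-map⁻ (a ∷_) p
... | _ , q , refl with ∈-insertions⁻ w q
... | u , v , refl , refl = a ∷ u , v , refl , refl

-- If x occurred in w, inserting it just before and just after that occurrence would give the same
-- word.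
insertions-unique : x ∉ w → Unique (insertions x w)
insertions-unique {w = []}        _  = [] ∷ []
insertions-unique {x} {w = y ∷ w} x∉ =
  All.tabulate (λ p eq → let _ , _ , eq′ = ∈-map⁻ _ p in x∉ (here (∷-injectiveˡ (trans eq eq′))))
  ∷ Uniqueₚ.map⁺ ∷-injectiveʳ (insertions-unique (x∉ ∘ there))

-- Undoes an insertion when x is not in the original word; hence different words have disjoint lists
-- of insertions.
delete : ℕ → List ℕ → List ℕ
delete x = filter (λ y → ¬? (x ≟ y))

delete-∉ : x ∉ w → delete x w ≡ w
delete-∉ {x} x∉ = filter-all (λ y → ¬? (x ≟ y)) (Allₚ.¬Any⇒All¬ _ x∉)

delete-insertion : x ∉ w → t ∈ insertions x w → delete x t ≡ w
delete-insertion {x} {w = []}    x∉ (here refl) = filter-reject (λ y → ¬? (x ≟ y)) (λ ¬eq → ¬eq refl)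
delete-insertion {x} {w = a ∷ w} x∉ (here refl) = trans (filter-reject (λ y → ¬? (x ≟ y)) (λ ¬eq → ¬eq refl)) (delete-∉ x∉)
delete-insertion {x} {w = a ∷ w} x∉ (there p) with ∈-map⁻ (a ∷_) p
... | _ , q , refl = trans (filter-accept (λ y → ¬? (x ≟ y)) (x∉ ∘ here)) (cong (a ∷_) (delete-insertion (x∉ ∘ there) q))

-- For relations that need a side condition on both members: the absence of 1 for pairings,
-- nonemptiness for layers.
AllPairs-under : ∀ {A : Set} {P : A → Set} {R : A → A → Set} {xs} →
                 All P xs → AllPairs (λ x y → P x → P y → R x y) xs → AllPairs R xs
AllPairs-under []         []       = []
AllPairs-under (px ∷ pxs) (r ∷ rs) = All.zipWith (λ (py , f) → f px py) (pxs , r) ∷ AllPairs-under pxs rs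

length-concatMap : ∀ {A B : Set} {f : A → List B} {c} xs → (∀ {x} → x ∈ xs → length (f x) ≡ c) →
                   length (concatMap f xs) ≡ length xs * c
length-concatMap []       h = refl
length-concatMap {f = f} (x ∷ xs) h =
  trans (length-++ (f x)) (cong₂ _+_ (h (here refl)) (length-concatMap xs (h ∘ there)))

⊆-insert⁻ : ∀ u {v} → All (x ≢_) s → s ⊆ u ++ x ∷ v → s ⊆ u ++ v
⊆-insert⁻ []      _        (_ ∷ʳ p)   = p
⊆-insert⁻ []      (x≢ ∷ _) (refl ∷ p) = contradiction refl x≢
⊆-insert⁻ (_ ∷ u) h        (_ ∷ʳ p)   = _ ∷ʳ ⊆-insert⁻ u h p
⊆-insert⁻ (_ ∷ u) (_ ∷ h)  (refl ∷ p) = refl ∷ ⊆-insert⁻ u h p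

-- Only one of the two occurrences can be the inserted letter; the other one remains.
repeated-insert⁻ : ∀ u {v} → x ∷ x ∷ [] ⊆ u ++ x ∷ v → x ∈ u ++ v
repeated-insert⁻ []      (_ ∷ʳ p)   = to∈ p
repeated-insert⁻ []      (refl ∷ p) = to∈ p
repeated-insert⁻ (_ ∷ u) (_ ∷ʳ p)   = there (repeated-insert⁻ u p)
repeated-insert⁻ (_ ∷ u) (refl ∷ p) = here refl

-- On partitions: a new first element in a block with one other new element, for which there are
-- `suc (length w)` places. This is the factor n + 1 of the recurrence.
pairings : List ℕ → List (List ℕ)
pairings w = map (1 ∷_) (insertions 1 (map suc w))

-- The first letter is either the only 1 or is paired with exactly one later 1.
words111 : ℕ → List (List ℕ)
words111 zero          = [ [] ]ₗ
words111 (suc zero)    = [ [ 1 ]ₗ ]ₗ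
words111 (suc (suc n)) = map grow (words111 (suc n)) ++ concatMap pairings (words111 n)

module _ where
  private
    Good : ℕ → List ℕ → Set
    Good = AvoidingRGF S111

    S111-suc : S111 x y z → S111 (suc x) (suc y) (suc z)
    S111-suc (refl , refl) = refl , refl

    S111-suc⁻ : S111 (suc x) (suc y) (suc z) → S111 x y z
    S111-suc⁻ (refl , refl) = refl , refl

    grow-good : Good n w → Good (suc n) (grow w)
    grow-good {w = w} (mk r av len) = mk (grow-RGF r) avoid (cong suc (trans (length-map suc w) len))
      where
      avoid : Avoids S111 (grow w)
      avoid (_ ∷ʳ p)   q             = Avoids-map {Q = S111} S111-suc⁻ av p q
      avoid (refl ∷ p) (refl , refl) = 1∉map-suc (RGF-positive r) (Sublist.lookup p (here refl))

    pairing-good : ∀ u v → map suc w ≡ u ++ v → Good n w → Good (suc (suc n)) (1 ∷ u ++ 1 ∷ v)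
    pairing-good {w = w} u v eq (mk r av len) = mk
      (new (RGF-insert-1 u (s≤s z≤n) (subst (RGF 1) eq (RGF-map-suc⁺ r))))
      -- A 111 through the leading 1 would need two more 1s, but only one was inserted.
      (λ { (_ ∷ʳ p) (refl , refl) → avoid p ; (refl ∷ p) (refl , refl) → 1∉ (repeated-insert⁻ u p) })
      (cong suc (trans (length-++ u) (trans (+-suc _ _) (cong suc
        (trans (sym (length-++ u)) (trans (cong length (sym eq)) (trans (length-map suc w) len)))))))
      where
      1∉ : 1 ∉ u ++ v
      1∉ = subst (1 ∉_) eq (1∉map-suc (RGF-positive r))
      avoid : ¬ (x ∷ x ∷ x ∷ [] ⊆ u ++ 1 ∷ v)
      avoid {x} p with 1 ≟ x
      ... | yes refl = 1∉ (repeated-insert⁻ u (∷ˡ⁻ p))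
      ... | no 1≢x   = Avoids-map {Q = S111} S111-suc⁻ av
                         (subst (_ ⊆_) (sym eq) (⊆-insert⁻ u (1≢x ∷ 1≢x ∷ 1≢x ∷ []) p)) (refl , refl)

    sound-step : ∀ n → (∀ {w} → w ∈ words111 (suc n) → Good (suc n) w) → (∀ {w} → w ∈ words111 n → Good n w) →
                 w ∈ words111 (suc (suc n)) → Good (suc (suc n)) w
    sound-step n ih₁ ih₀ w∈ with ∈-++⁻ (map grow (words111 (suc n))) w∈
    ... | inj₁ p with ∈-map⁻ grow p
    ... | _ , q , refl = grow-good (ih₁ q)
    sound-step n ih₁ ih₀ w∈ | inj₂ p with find (∈-concatMap⁻ pairings {xs = words111 n} p)
    ... | s , s∈ , q with ∈-map⁻ (1 ∷_) q
    ... | _ , q′ , refl with ∈-insertions⁻ (map suc s) q′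
    ... | u , v , eq , refl = pairing-good u v eq (ih₀ s∈)

    listed⇒good : ∀ n → w ∈ words111 n → Good n w
    listed⇒good zero       (here refl) = mk [] (λ ()) refl
    listed⇒good (suc zero) (here refl) = mk (new []) (λ { (_ ∷ ()) ; (_ ∷ʳ ()) }) refl
    listed⇒good (suc (suc n)) = sound-step n (listed⇒good (suc n)) (listed⇒good n)

    complete-step : ∀ n → (∀ {w} → Good (suc n) w → w ∈ words111 (suc n)) → (∀ {w} → Good n w → w ∈ words111 n) →
                    Good (suc (suc n)) w → w ∈ words111 (suc (suc n))
    complete-step n _ _ (mk (old (s≤s _) () _) _ _)
    complete-step n ih₁ ih₀ (mk (new {w = w} r) av len) with 1 ∈? w
    ... | no 1∉ with RGF-map-suc⁻ r 1∉
    ... | t , refl , r′ = ∈-++⁺ˡ (∈-map⁺ grow (ih₁ (mk r′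
          (Avoids-map⁻ {Q = S111} S111-suc (Avoids-⊆ {Q = S111} (1 ∷ʳ ⊆-refl) av))
          (trans (sym (length-map suc t)) (suc-injective len)))))
    complete-step n ih₁ ih₀ (mk (new {w = w} r) av len) | yes 1∈ with ∈-∃++ 1∈
    -- A 1 in `u ++ v` would be the third one and complete a 111; so the rest can be lowered.
    ... | u , v , refl with RGF-map-suc⁻ (RGF-remove-1 u (s≤s z≤n) r) (λ 1∈uv → av (refl ∷ twice u 1∈uv) (refl , refl))
      where
      twice : ∀ u {v} → 1 ∈ u ++ v → 1 ∷ 1 ∷ [] ⊆ u ++ 1 ∷ v
      twice []      p           = refl ∷ from∈ p
      twice (_ ∷ u) (here refl) = refl ∷ from∈ (∈-++⁺ʳ u (here refl))
      twice (_ ∷ u) (there p)   = _ ∷ʳ twice u p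
    ... | t , eq , r′ = ∈-++⁺ʳ (map grow (words111 (suc n)))
      (∈-concatMap⁺ pairings (lose (ih₀ good) (∈-map⁺ (1 ∷_)
        (subst (λ s → u ++ 1 ∷ v ∈ insertions 1 s) eq (∈-insertions⁺ u v)))))
      where
      good : Good n t
      good = mk r′
        (Avoids-map⁻ {Q = S111} S111-suc (subst (Avoids S111) eq
          (Avoids-⊆ {Q = S111} (1 ∷ʳ ++⁺ (⊆-refl {x = u}) (1 ∷ʳ ⊆-refl)) av)))
        (trans (sym (length-map suc t)) (trans (cong length (sym eq)) (trans (length-++ u)
          (suc-injective (trans (sym (+-suc (length u) (length v))) (trans (sym (length-++ u)) (suc-injective len)))))))

    good⇒listed : ∀ n → Good n w → w ∈ words111 n
    good⇒listed zero       (mk [] _ _)       = here refl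
    good⇒listed (suc zero) (mk (old (s≤s _) () _) _ _)
    good⇒listed (suc zero) (mk (new []) _ _) = here refl
    good⇒listed (suc (suc n)) = complete-step n (good⇒listed (suc n)) (good⇒listed n)

    -- Deleting the inserted 1 recovers the word that was paired, so pairings of different words
    -- differ; grown words differ from pairings in having no second 1.
    words-unique : ∀ n → Unique (words111 n)
    words-unique zero          = [] ∷ []
    words-unique (suc zero)    = [] ∷ []
    words-unique (suc (suc n)) = Uniqueₚ.++⁺
      (Uniqueₚ.map⁺ grow-injective (words-unique (suc n)))
      (Uniqueₚ.concat⁺
        (Allₚ.map⁺ (All.tabulate λ s∈ → Uniqueₚ.map⁺ ∷-injectiveʳ (insertions-unique (1∉ s∈))))
        (AllPairsₚ.map⁺ (AllPairs-under (All.tabulate 1∉) (AllPairs.map apart (words-unique n)))))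
      λ (p , q) → separate p (find (∈-concatMap⁻ pairings {xs = words111 n} q))
      where
      1∉ : ∀ {s} → s ∈ words111 n → 1 ∉ map suc s
      1∉ s∈ = 1∉map-suc (RGF-positive (rgf (listed⇒good n s∈)))
      apart : s ≢ t → 1 ∉ map suc s → 1 ∉ map suc t → Disjointₗ (pairings s) (pairings t)
      apart s≢t 1∉s 1∉t (p , q) with ∈-map⁻ (1 ∷_) p | ∈-map⁻ (1 ∷_) q
      ... | _ , p′ , refl | _ , q′ , refl =
        s≢t (map-injective suc-injective (trans (sym (delete-insertion 1∉s p′)) (delete-insertion 1∉t q′)))
      separate : ∀ {w} → w ∈ map grow (words111 (suc n)) → ¬ (∃[ s ] s ∈ words111 n × w ∈ pairings s)
      separate p (s , s∈ , q) with ∈-map⁻ grow p | ∈-map⁻ (1 ∷_) q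
      ... | t , t∈ , eq | _ , q′ , refl with ∈-insertions⁻ (map suc s) q′
      ... | u , v , _ , refl =
        1∉map-suc (RGF-positive (rgf (listed⇒good (suc n) t∈))) (subst (1 ∈_) (∷-injectiveʳ eq) (∈-++⁺ʳ u (here refl)))

  list111 : ∀ n → Lists (AvoidingRGF S111 n) (words111 n)
  list111 n = record { unique = words-unique n ; sound = listed⇒good n ; complete = good⇒listed n }

  length-words111 : ∀ n → length (words111 (suc (suc n))) ≡ length (words111 (suc n)) + length (words111 n) * suc n
  length-words111 n = trans (length-++ (map grow (words111 (suc n))))
    (cong₂ _+_ (length-map grow (words111 (suc n)))
      (length-concatMap (words111 n) λ {s} s∈ → trans (length-map _ (insertions 1 (map suc s)))
        (trans (length-insertions 1 (map suc s)) (cong suc (trans (length-map suc s) (len (listed⇒good n s∈)))))))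

-- The number of matchings

absorption : ∀ n k → suc k * (suc n C suc k) ≡ suc n * (n C k)
absorption zero    zero    = refl
absorption zero    (suc k) = *-zeroʳ (suc (suc k))
absorption (suc n) zero    = trans (+-identityʳ _) (trans (nC1≡n (suc (suc n))) (sym (*-identityʳ (suc (suc n)))))
absorption (suc n) (suc k) = begin
  suc (suc k) * (suc (suc n) C suc (suc k))
    ≡⟨ cong (suc (suc k) *_) (nCk+nC[k+1]≡[n+1]C[k+1] (suc n) (suc k)) ⟨
  suc (suc k) * (p + q)
    -- One copy of `p` is set aside, which leaves exactly the coefficients of the induction
    -- hypotheses for `k` and `suc k`.
    ≡⟨ split k p q ⟩
  p + (suc k * p + suc (suc k) * q)
    ≡⟨ cong (p +_) (cong₂ _+_ (absorption n k) (absorption n (suc k))) ⟩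
  p + (suc n * (n C k) + suc n * (n C suc k))
    ≡⟨ cong (p +_) (*-distribˡ-+ (suc n) (n C k) (n C suc k)) ⟨
  p + suc n * (n C k + n C suc k)
    ≡⟨ cong (λ c → p + suc n * c) (nCk+nC[k+1]≡[n+1]C[k+1] n k) ⟩
  suc (suc n) * p ∎
  where
  p q : ℕ
  p = suc n C suc k
  q = suc n C suc (suc k)
  split : ∀ k p q → suc (suc k) * (p + q) ≡ p + (suc k * p + suc (suc k) * q)
  split = solve-∀

Σ< : ℕ → (ℕ → ℕ) → ℕ
Σ< n f = sum (applyUpTo f n)

Σ<-cong : ∀ n {f g : ℕ → ℕ} → (∀ i → f i ≡ g i) → Σ< n f ≡ Σ< n g
Σ<-cong zero    eq = refl
Σ<-cong (suc n) eq = cong₂ _+_ (eq 0) (Σ<-cong n (eq ∘ suc))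

Σ<-linear : ∀ n c (f g : ℕ → ℕ) → Σ< n (λ i → f i + c * g i) ≡ Σ< n f + c * Σ< n g
Σ<-linear zero    c f g = sym (*-zeroʳ c)
Σ<-linear (suc n) c f g =
  trans (cong ((f 0 + c * g 0) +_) (Σ<-linear n c (f ∘ suc) (g ∘ suc)))
        (rearrange c (f 0) (g 0) (Σ< n (f ∘ suc)) (Σ< n (g ∘ suc)))
  where
  rearrange : ∀ c a b s t → a + c * b + (s + c * t) ≡ a + s + c * (b + t)
  rearrange = solve-∀

-- Shifting the index in the recurrence leaves both sums one summand too long; this removes it.
Σ<-last : ∀ n (f : ℕ → ℕ) → f n ≡ 0 → Σ< (suc n) f ≡ Σ< n f
Σ<-last n f fn≡0 = begin
  Σ< (suc n) f                ≡⟨ cong sum (applyUpTo-∷ʳ f n) ⟨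
  sum (applyUpTo f n ++ [ f n ]ₗ) ≡⟨ sum-++ (applyUpTo f n) [ f n ]ₗ ⟩
  Σ< n f + (f n + 0)          ≡⟨ cong (Σ< n f +_) (trans (+-identityʳ (f n)) fn≡0) ⟩
  Σ< n f + 0                  ≡⟨ +-identityʳ _ ⟩
  Σ< n f                      ∎

matchings : ℕ → ℕ → ℕ
matchings n i = (n C (2 * i)) * [2 i ]!!

-- Even 2i > n suffices for vanishing; i > n is all that is needed to let a sum up to n stand for
-- the infinite one.
matchings-vanish : ∀ {n i} → n < i → matchings n i ≡ 0
matchings-vanish {n} {i} n<i = cong (_* [2 i ]!!) (k>n⇒nCk≡0 (<-≤-trans n<i (m≤m+n i (i + 0))))

-- Matchings of n + 2 elements with i + 1 pairs, split by whether the first element is alone. In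
-- formulas: Pascal's rule, then (2i + 1) C(n + 1, 2i + 1) = (n + 1) C(n, 2i).
matchings-step : ∀ n i → matchings (suc (suc n)) (suc i) ≡ matchings (suc n) (suc i) + suc n * matchings n i
matchings-step n i = begin
  (suc (suc n) C (2 * suc i)) * (d * suc e)
    ≡⟨ cong (λ j → (suc (suc n) C j) * (d * suc e)) (*-suc 2 i) ⟩
  (suc (suc n) C suc (suc e)) * (d * suc e)
    ≡⟨ cong (_* (d * suc e)) (nCk+nC[k+1]≡[n+1]C[k+1] (suc n) (suc e)) ⟨
  ((suc n C suc e) + (suc n C suc (suc e))) * (d * suc e)
    ≡⟨ expand (suc n C suc e) (suc n C suc (suc e)) d e ⟩
  (suc n C suc (suc e)) * (d * suc e) + (suc e * (suc n C suc e)) * d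
    ≡⟨ cong₂ _+_ (cong (λ j → (suc n C j) * (d * suc e)) (sym (*-suc 2 i)))
                 (trans (cong (_* d) (absorption n e)) (reassoc (suc n) (n C e) d)) ⟩
  matchings (suc n) (suc i) + suc n * matchings n i ∎
  where
  d e : ℕ
  d = [2 i ]!!
  e = 2 * i
  expand : ∀ p q d e → (p + q) * (d * suc e) ≡ q * (d * suc e) + (suc e * p) * d
  expand = solve-∀
  reassoc : ∀ a b c → a * b * c ≡ a * (b * c)
  reassoc = solve-∀

matchings-recurrence : ∀ n → Σ< (suc (suc (suc n))) (matchings (suc (suc n)))
                           ≡ Σ< (suc (suc n)) (matchings (suc n)) + suc n * Σ< (suc n) (matchings n)
matchings-recurrence n = begin
  -- The summand for i = 0 is 1 whatever n is. It is carried along as `suc` and finally serves as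
  -- the first summand for `suc n`.
  suc (Σ< (suc (suc n)) (matchings (suc (suc n)) ∘ suc))
    ≡⟨ cong suc (Σ<-cong (suc (suc n)) (matchings-step n)) ⟩
  suc (Σ< (suc (suc n)) (λ i → matchings (suc n) (suc i) + suc n * matchings n i))
    ≡⟨ cong suc (Σ<-linear (suc (suc n)) (suc n) (matchings (suc n) ∘ suc) (matchings n)) ⟩
  Σ< (suc (suc (suc n))) (matchings (suc n)) + suc n * Σ< (suc (suc n)) (matchings n)
    ≡⟨ cong₂ (λ a b → a + suc n * b)
             (Σ<-last (suc (suc n)) (matchings (suc n)) (matchings-vanish {suc n} ≤-refl))
             (Σ<-last (suc n) (matchings n) (matchings-vanish {n} ≤-refl)) ⟩
  Σ< (suc (suc n)) (matchings (suc n)) + suc n * Σ< (suc n) (matchings n) ∎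

length-words111-formula : ∀ n → length (words111 n) ≡ Σ< (suc n) (matchings n)
length-words111-formula zero          = refl
length-words111-formula (suc zero)    = refl
length-words111-formula (suc (suc n)) = begin
  length (words111 (suc (suc n)))
    ≡⟨ length-words111 n ⟩
  length (words111 (suc n)) + length (words111 n) * suc n
    ≡⟨ cong₂ _+_ (length-words111-formula (suc n))
                 (trans (cong (_* suc n) (length-words111-formula n)) (*-comm _ (suc n))) ⟩
  Σ< (suc (suc n)) (matchings (suc n)) + suc n * Σ< (suc n) (matchings n)
    ≡⟨ matchings-recurrence n ⟨
  Σ< (suc (suc (suc n))) (matchings (suc (suc n))) ∎

length-words111-sum : ∀ n → length (words111 n) ≡ sum (map (λ i → (n C (2 * i)) * [2 i ]!!) (upTo (suc n)))
length-words111-sum n = trans (length-words111-formula n) (cong sum (sym (map-upTo (matchings n) (suc n))))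

-- Partitions and their restricted growth functions

module _ {P : Fin n → Set} (P? : Decidable P) where

  ∈-comprehension⁺ : ∀ {i} → P i → i ∈ₛ Vec.tabulate (does ∘ P?)
  ∈-comprehension⁺ {i} p = Vecₚ.lookup⇒[]= i _ (trans (Vecₚ.lookup∘tabulate (does ∘ P?) i) (dec-true (P? i) p))

  ∈-comprehension⁻ : ∀ {i} → i ∈ₛ Vec.tabulate (does ∘ P?) → P i
  ∈-comprehension⁻ {i} i∈ with P? i | trans (sym (Vecₚ.lookup∘tabulate (does ∘ P?) i)) (Vecₚ.[]=⇒lookup i∈)
  ... | yes p | _ = p
  ... | no _  | ()

∈-⋃⁺ : ∀ {i : Fin n} → S ∈ Cs → i ∈ₛ S → i ∈ₛ ⋃ Cs
∈-⋃⁺ (here refl) i∈ = x∈p∪q⁺ (inj₁ i∈)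
∈-⋃⁺ (there S∈)  i∈ = x∈p∪q⁺ (inj₂ (∈-⋃⁺ S∈ i∈))

⁅⁆-⊆ : ∀ {i : Fin n} → i ∈ₛ S → ⁅ i ⁆ ⊆ₛ S
⁅⁆-⊆ {S = S} {i} i∈ p = subst (_∈ₛ S) (sym (x∈⁅y⁆⇒x≡y i p)) i∈

min-≤ : ∀ {i : Fin n} → i ∈ₛ S → min S ≤ suc (toℕ i)
min-≤ here = ≤-refl
min-≤ {S = inside  Vec.∷ _} (there i∈) = s≤s z≤n
min-≤ {S = outside Vec.∷ _} (there i∈) = s≤s (min-≤ i∈)

min-attained : Nonempty S → ∃[ i ] i ∈ₛ S × min S ≡ suc (toℕ i)
min-attained {S = inside  Vec.∷ _} _ = zero , here , refl
min-attained {S = outside Vec.∷ _} (suc i , there i∈) with min-attained (i , i∈)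
... | j , j∈ , eq = suc j , there j∈ , cong suc eq

-- Positions count from 1, as index does.
data Nth {A : Set} : List A → ℕ → A → Set where
  here  : ∀ {x xs} → Nth (x ∷ xs) 1 x
  there : ∀ {x y xs v} → Nth xs v y → Nth (x ∷ xs) (suc v) y

module _ {A : Set} where

  Nth⇒∈ : ∀ {xs v} {x : A} → Nth xs v x → x ∈ xs
  Nth⇒∈ here      = here refl
  Nth⇒∈ (there p) = there (Nth⇒∈ p)

  ∈⇒Nth : ∀ {xs} {x : A} → x ∈ xs → ∃[ v ] Nth xs v x
  ∈⇒Nth (here refl) = 1 , here
  ∈⇒Nth (there p)   = let v , q = ∈⇒Nth p in suc v , there q

  Nth-positive : ∀ {xs v} {x : A} → Nth xs v x → 1 ≤ v
  Nth-positive here      = s≤s z≤n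
  Nth-positive (there _) = s≤s z≤n

  Nth-≤length : ∀ {xs v} {x : A} → Nth xs v x → v ≤ length xs
  Nth-≤length here      = s≤s z≤n
  Nth-≤length (there p) = s≤s (Nth-≤length p)

  Nth-total : ∀ xs {v} → 1 ≤ v → v ≤ length xs → ∃[ x ] Nth {A} xs v x
  Nth-total (x ∷ _)  {suc zero}    _ _         = x , here
  Nth-total (_ ∷ xs) {suc (suc v)} _ (s≤s v≤l) = let x , p = Nth-total xs (s≤s z≤n) v≤l in x , there p

  Nth-functional : ∀ {xs v} {x y : A} → Nth xs v x → Nth xs v y → x ≡ y
  Nth-functional here      here      = refl
  Nth-functional (there p) (there q) = Nth-functional p q

  Nth-AllPairs : ∀ {R : A → A → Set} {xs u v x y} → AllPairs R xs → u < v → Nth xs u x → Nth xs v y → R x y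
  Nth-AllPairs _       (s≤s ())  here      here
  Nth-AllPairs (r ∷ _) _         here      (there q) = All.lookup r (Nth⇒∈ q)
  Nth-AllPairs (_ ∷ r) (s≤s u<v) (there p) (there q) = Nth-AllPairs r u<v p q

  Nth-applyUpTo : ∀ (g : ℕ → A) {l v} → v < l → Nth (applyUpTo g l) (suc v) (g v)
  Nth-applyUpTo g {suc l} {zero}  _         = here
  Nth-applyUpTo g {suc l} {suc v} (s≤s v<l) = there (Nth-applyUpTo (g ∘ suc) v<l)

  Nth-ext : ∀ (g : ℕ → A) xs → (∀ {v x} → Nth xs (suc v) x → x ≡ g v) → xs ≡ applyUpTo g (length xs)
  Nth-ext g []       h = refl
  Nth-ext g (x ∷ xs) h = cong₂ _∷_ (h here) (Nth-ext (g ∘ suc) xs (h ∘ there))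

-- A nonempty set lies in at most one of several disjoint blocks, so the first hit of `index` is the
-- block at position v.
Nth-index : AllPairs Disjoint Cs → Nth Cs v S → D ⊆ₛ S → Nonempty D → index Cs D ≡ v
Nth-index {Cs = S ∷ _} {D = D} _ here D⊆S _ with D ⊆? S
... | yes _  = refl
... | no D⊈S = contradiction (λ {x} → D⊆S {x}) D⊈S
Nth-index {Cs = S ∷ _} {D = D} (apart ∷ dj) (there p) D⊆S (i , i∈) with D ⊆? S
... | yes D⊆S′ = contradiction (i , x∈p∩q⁺ (D⊆S′ i∈ , D⊆S i∈)) (All.lookup apart (Nth⇒∈ p))
... | no _     = cong suc (Nth-index dj p D⊆S (i , i∈))

index-Nth : ∀ Cs {i : Fin n} → i ∈ₛ ⋃ Cs → ∃[ S ] Nth Cs (index Cs ⁅ i ⁆) S × i ∈ₛ S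
index-Nth []       i∈ = contradiction i∈ ∉⊥
index-Nth (S ∷ Cs) {i} i∈ with ⁅ i ⁆ ⊆? S
... | yes i⊆S = S , here , i⊆S (x∈⁅x⁆ i)
... | no i⊈S with x∈p∪q⁻ S (⋃ Cs) i∈
...   | inj₁ i∈S = contradiction (λ {x} → ⁅⁆-⊆ i∈S {x}) i⊈S
...   | inj₂ i∈⋃ = let D , p , i∈D = index-Nth Cs i∈⋃ in D , there p , i∈D

module Blocks (σ : Π n) where

  Bs : List (Subset n)
  Bs = blocksΠ σ

  f : Fin n → ℕ
  f i = B σ ⁅ i ⁆

  block : ∀ i → ∃[ S ] Nth Bs (f i) S × i ∈ₛ S
  block i = index-Nth Bs (subst (i ∈ₛ_) (sym (covers (partition σ))) ∈⊤)

  B-block : Nth Bs v S → D ⊆ₛ S → Nonempty D → B σ D ≡ v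
  B-block = Nth-index (disjoint (partition σ))

  ∈⇒f≡ : ∀ {i} → Nth Bs v S → i ∈ₛ S → f i ≡ v
  ∈⇒f≡ {i = i} p i∈ = B-block p (⁅⁆-⊆ i∈) (i , x∈⁅x⁆ i)

  f≡⇒∈ : ∀ {i} → Nth Bs v S → f i ≡ v → i ∈ₛ S
  f≡⇒∈ {i = i} p refl with block i
  ... | D , q , i∈ with Nth-functional p q
  ... | refl = i∈

  element : Nth Bs v S → ∃[ i ] f i ≡ v × i ∈ₛ S
  element p = let i , i∈ = All.lookup (nonempty (partition σ)) (Nth⇒∈ p) in i , ∈⇒f≡ p i∈ , i∈

  surjective : 1 ≤ v → v ≤ length Bs → ∃[ i ] f i ≡ v
  surjective 1≤v v≤l = let S , p = Nth-total Bs 1≤v v≤l ; i , fi≡v , _ = element p in i , fi≡v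

  f-positive : ∀ i → 1 ≤ f i
  f-positive i = let _ , p , _ = block i in Nth-positive p

  f-≤length : ∀ i → f i ≤ length Bs
  f-≤length i = let _ , p , _ = block i in Nth-≤length p

  -- The witness is the minimum of the v-th block. By canonical order it is smaller than the minimum
  -- of the block of i, hence smaller than i.
  predecessor : ∀ i {v} → 1 ≤ v → v < f i → ∃[ j ] j Fin.< i × f j ≡ v
  predecessor i 1≤v v<fi =
    let S , p , i∈ = block i
        D , q = Nth-total Bs 1≤v (≤-trans (<⇒≤ v<fi) (f-≤length i))
        j , j∈ , minD≡ = min-attained (All.lookup (nonempty (partition σ)) (Nth⇒∈ q))
    in j , s≤s⁻¹ (subst (_< suc (toℕ i)) minD≡ (<-≤-trans (Nth-AllPairs (canonical σ) v<fi q p) (min-≤ i∈)))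
         , ∈⇒f≡ q j∈

-- Only values above m need an earlier occurrence, as smaller ones may precede this segment. At
-- position zero nothing is earlier, which rules out a jump beyond `suc m`.
tabulate-RGF : (f : Fin n → ℕ) → (∀ i → 1 ≤ f i) → (∀ i {v} → m < v → v < f i → ∃[ j ] j Fin.< i × f j ≡ v) →
               RGF m (tabulate f)
tabulate-RGF {zero}      f pos pred = []
tabulate-RGF {suc n} {m} f pos pred with <-cmp (f zero) (suc m)
... | tri> _ _ sm<f0 = contradiction (proj₁ (proj₂ (pred zero ≤-refl sm<f0))) λ ()
... | tri< (s≤s f0≤m) _ _ = old (pos zero) f0≤m (tabulate-RGF (f ∘ suc) (pos ∘ suc) pred′)
  where
  pred′ : ∀ i {v} → m < v → v < f (suc i) → ∃[ j ] j Fin.< i × f (suc j) ≡ v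
  pred′ i m<v v<f with pred (suc i) m<v v<f
  ... | suc j , s≤s j<i , eq = j , j<i , eq
  ... | zero  , _ , refl = contradiction f0≤m (<⇒≱ m<v)
... | tri≈ _ f0≡ _ rewrite f0≡ = new (tabulate-RGF (f ∘ suc) (pos ∘ suc) pred′)
  where
  pred′ : ∀ i {v} → suc m < v → v < f (suc i) → ∃[ j ] j Fin.< i × f (suc j) ≡ v
  pred′ i m<v v<f with pred (suc i) (<⇒≤ m<v) v<f
  ... | suc j , s≤s j<i , eq = j , j<i , eq
  ... | zero  , _ , refl = contradiction f0≡ (λ eq → <-irrefl (sym eq) m<v)

ρ-RGF : (σ : Π n) → RGF 0 (ρ σ)
ρ-RGF σ = tabulate-RGF f f-positive predecessor where open Blocks σ

level : (Fin n → ℕ) → ℕ → Subset n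
level f v = Vec.tabulate λ i → does (f i ≟ v)

Nth⇒level : ∀ (σ : Π n) {v S} → Nth (blocksΠ σ) v S → S ≡ level (λ i → B σ ⁅ i ⁆) v
Nth⇒level σ p = ⊆-antisym
  (λ i∈ → ∈-comprehension⁺ (λ i → f i ≟ _) (∈⇒f≡ p i∈))
  (λ i∈ → f≡⇒∈ p (∈-comprehension⁻ (λ i → f i ≟ _) i∈))
  where open Blocks σ

blocks≡levels : (σ : Π n) → blocksΠ σ ≡ applyUpTo (level (λ i → B σ ⁅ i ⁆) ∘ suc) (length (blocksΠ σ))
blocks≡levels σ = Nth-ext _ (blocksΠ σ) (Nth⇒level σ)

tabulate-injective : ∀ {f g : Fin n → ℕ} → tabulate f ≡ tabulate g → f ≗ g
tabulate-injective eq zero    = proj₁ (∷-injective eq)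
tabulate-injective eq (suc i) = tabulate-injective (proj₂ (∷-injective eq)) i

-- Both lists consist of level sets of the same function. Their lengths agree because the index of
-- the last block is itself a value of that function.
ρ-injective : (σ τ : Π n) → ρ σ ≡ ρ τ → blocksΠ σ ≡ blocksΠ τ
ρ-injective {n} σ τ eq = trans (blocks≡levels σ) (trans
  (cong₂ (λ (g : ℕ → Subset n) l → applyUpTo g l) refl (≤-antisym (length-≤ σ τ f≗g) (length-≤ τ σ (sym ∘ f≗g))))
  (trans (applyUpTo-cong (λ v → Vecₚ.tabulate-cong λ i → cong (λ a → does (a ≟ suc v)) (f≗g i)) (length (blocksΠ τ)))
         (sym (blocks≡levels τ))))
  where
  f≗g : ∀ i → B σ ⁅ i ⁆ ≡ B τ ⁅ i ⁆
  f≗g = tabulate-injective eq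
  applyUpTo-cong : ∀ {A : Set} {g h : ℕ → A} → g ≗ h → ∀ l → applyUpTo g l ≡ applyUpTo h l
  applyUpTo-cong g≗h zero    = refl
  applyUpTo-cong g≗h (suc l) = cong₂ _∷_ (g≗h 0) (applyUpTo-cong (g≗h ∘ suc) l)
  length-≤ : ∀ σ τ → (∀ i → B σ ⁅ i ⁆ ≡ B τ ⁅ i ⁆) → length (blocksΠ {n} σ) ≤ length (blocksΠ τ)
  length-≤ σ τ f≗g with length (blocksΠ σ) in eq
  ... | zero  = z≤n
  ... | suc l with Blocks.surjective σ {suc l} (s≤s z≤n) (≤-reflexive (sym eq))
  ... | i , fi≡ = subst (_≤ _) (trans (sym (f≗g i)) fi≡) (Blocks.f-≤length τ i)

RGF-predecessor-index : RGF m w → ∀ i {v} → m < v → v < lookup w i → ∃[ j ] j Fin.< i × lookup w j ≡ v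
RGF-predecessor-index (old _ a≤m r) zero    m<v v<a = contradiction (<-trans m<v v<a) (<⇒≱ (s≤s a≤m))
RGF-predecessor-index (new r)       zero    m<v v<a = contradiction v<a (<⇒≱ (s≤s m<v))
RGF-predecessor-index (old _ _ r)   (suc i) m<v v<  =
  let j , j<i , eq = RGF-predecessor-index r i m<v v< in suc j , s≤s j<i , eq
RGF-predecessor-index (new r)       (suc i) m<v v<  with m≤n⇒m<n∨m≡n m<v
... | inj₁ sm<v = let j , j<i , eq = RGF-predecessor-index r i sm<v v< in suc j , s≤s j<i , eq
... | inj₂ refl = zero , s≤s z≤n , refl

-- For `realise`, l is the number of blocks: all letters lie below it, and since every value up to
-- it occurs no level set is empty.
RGF-maximum : RGF m w → ∃[ l ] m ≤ l × (∀ i → lookup w i ≤ l) × (∀ {v} → m < v → v ≤ l → ∃[ i ] lookup w i ≡ v)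
RGF-maximum {m} []  = m , ≤-refl , (λ ()) , λ m<v v≤m → contradiction v≤m (<⇒≱ m<v)
RGF-maximum (old _ a≤m r) with RGF-maximum r
... | l , m≤l , bound , onto =
  l , m≤l , (λ { zero → ≤-trans a≤m m≤l ; (suc i) → bound i }) ,
  λ m<v v≤l → let i , eq = onto m<v v≤l in suc i , eq
RGF-maximum {m} (new {w = w} r) with RGF-maximum r
... | l , m<l , bound , onto =
  l , <⇒≤ m<l , (λ { zero → m<l ; (suc i) → bound i }) , onto′
  where
  onto′ : ∀ {v} → m < v → v ≤ l → ∃[ i ] lookup (suc m ∷ w) i ≡ v
  onto′ m<v v≤l with m≤n⇒m<n∨m≡n m<v
  ... | inj₁ sm<v = let i , eq = onto sm<v v≤l in suc i , eq
  ... | inj₂ refl = zero , refl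

realise : RGF 0 w → ∃[ σ ] ρ {length w} σ ≡ w
realise {w} r = σ , trans (tabulate-cong ρ-at) (tabulate-lookup w)
  where
  g : Fin (length w) → ℕ
  g = lookup w

  l : ℕ
  l = proj₁ (RGF-maximum r)

  g-≤ : ∀ i → g i ≤ l
  g-≤ = proj₁ (proj₂ (proj₂ (RGF-maximum r)))

  g-positive : ∀ i → 1 ≤ g i
  g-positive i = All.lookup (RGF-positive r) (∈-lookup i)

  Ls : List (Subset (length w))
  Ls = applyUpTo (level g ∘ suc) l

  level-nonempty : ∀ {v} → v < l → Nonempty (level g (suc v))
  level-nonempty v<l with proj₂ (proj₂ (proj₂ (RGF-maximum r))) (s≤s z≤n) v<l
  ... | i , eq = i , ∈-comprehension⁺ (λ i → g i ≟ _) eq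

  level-disjoint : ∀ {u v} → u < v → Disjoint (level g (suc u)) (level g (suc v))
  level-disjoint {u} {v} u<v (i , i∈) =
    let p , q = x∈p∩q⁻ (level g (suc u)) (level g (suc v)) i∈
    in <-irrefl (suc-injective (trans
      (sym (∈-comprehension⁻ (λ i → g i ≟ suc u) p)) (∈-comprehension⁻ (λ i → g i ≟ suc v) q))) u<v

  -- The smaller value has already occurred before the minimum of the later level, so the levels
  -- come in canonical order.
  level-min : ∀ {u v} → u < v → v < l → min (level g (suc u)) < min (level g (suc v))
  level-min {u} {v} u<v v<l with min-attained (level-nonempty v<l)
  ... | i , i∈ , eq with RGF-predecessor-index r i (s≤s z≤n)
    (subst (suc u <_) (sym (∈-comprehension⁻ (λ i → g i ≟ suc v) i∈)) (s≤s u<v))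
  ... | j , j<i , gj≡ = subst (min (level g (suc u)) <_) (sym eq)
    (s≤s (≤-trans (min-≤ (∈-comprehension⁺ (λ i → g i ≟ suc u) gj≡)) j<i))

  level-Nth : ∀ i → Nth Ls (g i) (level g (g i))
  level-Nth i with g i | g-positive i | g-≤ i
  ... | suc v | _ | v<l = Nth-applyUpTo (level g ∘ suc) v<l

  i∈level : ∀ i → i ∈ₛ level g (g i)
  i∈level i = ∈-comprehension⁺ (λ j → g j ≟ g i) refl

  σ : Π (length w)
  σ = record
    { partition = record
      { blocks   = Ls
      ; nonempty = Allₚ.applyUpTo⁺₁ _ l level-nonempty
      ; disjoint = AllPairsₚ.applyUpTo⁺₁ _ l λ u<v _ → level-disjoint u<v
      ; covers   = ⊆-antisym ⊆⊤ λ {i} _ → ∈-⋃⁺ (Nth⇒∈ (level-Nth i)) (i∈level i)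
      }
    ; canonical = AllPairsₚ.applyUpTo⁺₁ _ l level-min
    }

  ρ-at : ∀ i → B σ ⁅ i ⁆ ≡ g i
  ρ-at i = Blocks.∈⇒f≡ σ (level-Nth i) (i∈level i)

lookup-injective : ∀ {A : Set} {xs : List A} → Unique xs → ∀ i j → lookup xs i ≡ lookup xs j → i ≡ j
lookup-injective (_ ∷ _)  zero    zero    _  = refl
lookup-injective (x∉ ∷ _) zero    (suc j) eq = contradiction eq (All.lookup x∉ (∈-lookup j))
lookup-injective (x∉ ∷ _) (suc i) zero    eq = contradiction (sym eq) (All.lookup x∉ (∈-lookup i))
lookup-injective (_ ∷ un) (suc i) (suc j) eq = cong suc (lookup-injective un i j eq)

module _ {π : Π m} {Q : Shape} {a b c} (ρπ : ρ π ≡ a ∷ b ∷ c ∷ []) (Q-char : Q Characterises (a ∷ b ∷ c ∷ [])) where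

  R⇒avoids : ∀ (σ : Π n) → R n π σ → Avoids Q (ρ σ)
  R⇒avoids σ σ∈R p q = σ∈R (subst (ρ σ contains_) (sym ρπ) (occurs⇒contains Q-char (_ , _ , _ , p , q)))

  avoids⇒R : ∀ (σ : Π n) → Avoids Q (ρ σ) → R n π σ
  avoids⇒R σ av c with contains⇒occurs Q-char (subst (ρ σ contains_) ρπ c)
  ... | _ , _ , _ , p , q = av p q

  -- Uniqueness in L makes the position of `ρ σ` depend on the word alone, and `ρ-injective` turns
  -- agreement of words back into equality of blocks.
  #R : ∀ {L} → Lists (AvoidingRGF Q n) L → # (R n π) is length L
  #R {n} {L} lists = record
    { to        = to
    ; from      = from
    ; to-cong   = λ {x} {y} eq → lookup-injective (unique lists) _ _
                    (trans (to-lookup x) (trans (cong (λ Cs → tabulate λ i → index Cs ⁅ i ⁆) eq) (sym (to-lookup y))))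
    ; from-cong = λ { refl → refl }
    ; inverse   = (λ {i} {x} eq → lookup-injective (unique lists) _ _
                    (trans (to-lookup x) (trans (cong (λ Cs → tabulate λ i → index Cs ⁅ i ⁆) eq) (from-ρ i))))
                , λ { {x} refl → ρ-injective (proj₁ (from (to x))) (proj₁ x) (trans (from-ρ (to x)) (to-lookup x)) }
    }
    where
    good : ∀ (x : ∃ (R n π)) → AvoidingRGF Q n (ρ (proj₁ x))
    good (σ , σ∈R) = mk (ρ-RGF σ) (R⇒avoids σ σ∈R) (length-tabulate _)

    to : ∃ (R n π) → Fin (length L)
    to x = Any.index (complete lists (good x))

    to-lookup : ∀ x → lookup L (to x) ≡ ρ (proj₁ x)
    to-lookup x = sym (Anyₚ.lookup-index (complete lists (good x)))

    realised : ∀ i → ∃[ σ ] ρ {n} σ ≡ lookup L i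
    realised i with sound lists (∈-lookup {xs = L} i)
    ... | mk r _ refl = realise r

    from : Fin (length L) → ∃ (R n π)
    from i = proj₁ (realised i) , avoids⇒R (proj₁ (realised i))
      (subst (Avoids Q) (sym (proj₂ (realised i))) (avoids (sound lists (∈-lookup i))))

    from-ρ : ∀ i → ρ (proj₁ (from i)) ≡ lookup L i
    from-ρ i = proj₂ (realised i)

-- Subsequences of letters as increasing positions

tabulate-⊆₁ : ∀ (f : Fin n → ℕ) i → f i ∷ [] ⊆ tabulate f
tabulate-⊆₁ f i = from∈ (∈-tabulate⁺ i)

tabulate-⊆₂ : ∀ (f : Fin n → ℕ) {i j} → i Fin.< j → f i ∷ f j ∷ [] ⊆ tabulate f
tabulate-⊆₂ f {zero}  {suc j} _         = refl ∷ tabulate-⊆₁ (f ∘ suc) j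
tabulate-⊆₂ f {suc i} {suc j} (s≤s i<j) = _ ∷ʳ tabulate-⊆₂ (f ∘ suc) i<j

tabulate-⊆₃ : ∀ (f : Fin n → ℕ) {i j k} → i Fin.< j → j Fin.< k → f i ∷ f j ∷ f k ∷ [] ⊆ tabulate f
tabulate-⊆₃ f {zero}  {suc j} {suc k} _         (s≤s j<k) = refl ∷ tabulate-⊆₂ (f ∘ suc) j<k
tabulate-⊆₃ f {suc i} {suc j} {suc k} (s≤s i<j) (s≤s j<k) = _ ∷ʳ tabulate-⊆₃ (f ∘ suc) i<j j<k

⊆₁-tabulate : ∀ (f : Fin n → ℕ) → x ∷ [] ⊆ tabulate f → ∃[ i ] f i ≡ x
⊆₁-tabulate {suc n} f (refl ∷ _) = zero , refl
⊆₁-tabulate {suc n} f (_ ∷ʳ p)   = let i , eq = ⊆₁-tabulate (f ∘ suc) p in suc i , eq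

⊆₂-tabulate : ∀ (f : Fin n → ℕ) → x ∷ y ∷ [] ⊆ tabulate f → ∃[ i ] ∃[ j ] i Fin.< j × f i ≡ x × f j ≡ y
⊆₂-tabulate {suc n} f (refl ∷ p) = let j , eq = ⊆₁-tabulate (f ∘ suc) p in zero , suc j , s≤s z≤n , refl , eq
⊆₂-tabulate {suc n} f (_ ∷ʳ p)   = let i , j , i<j , eqs = ⊆₂-tabulate (f ∘ suc) p in suc i , suc j , s≤s i<j , eqs

⊆₃-tabulate : ∀ (f : Fin n → ℕ) → x ∷ y ∷ z ∷ [] ⊆ tabulate f →
              ∃[ i ] ∃[ j ] ∃[ k ] i Fin.< j × j Fin.< k × f i ≡ x × f j ≡ y × f k ≡ z
⊆₃-tabulate {suc n} f (refl ∷ p) =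
  let j , k , j<k , eqs = ⊆₂-tabulate (f ∘ suc) p in zero , suc j , suc k , s≤s z≤n , s≤s j<k , refl , eqs
⊆₃-tabulate {suc n} f (_ ∷ʳ p)   =
  let i , j , k , i<j , j<k , eqs = ⊆₃-tabulate (f ∘ suc) p in suc i , suc j , suc k , s≤s i<j , s≤s j<k , eqs

-- The five avoidance classes

AvoidsAt : Shape → (Fin n → ℕ) → Set
AvoidsAt Q f = ∀ {i j k} → i Fin.< j → j Fin.< k → ¬ Q (f i) (f j) (f k)

module _ {π : Π m} {Q : Shape} {a b c} (ρπ : ρ π ≡ a ∷ b ∷ c ∷ []) (Q-char : Q Characterises (a ∷ b ∷ c ∷ []))
         (σ : Π n) where
  open Blocks σ

  R⇒avoidsAt : R n π σ → AvoidsAt Q f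
  R⇒avoidsAt σ∈R i<j j<k = R⇒avoids {π = π} ρπ Q-char σ σ∈R (tabulate-⊆₃ f i<j j<k)

  avoidsAt⇒R : AvoidsAt Q f → R n π σ
  avoidsAt⇒R av = avoids⇒R {π = π} ρπ Q-char σ λ p q → go (⊆₃-tabulate f p) q
    where
    go : ∀ {x y z} → ∃[ i ] ∃[ j ] ∃[ k ] i Fin.< j × j Fin.< k × f i ≡ x × f j ≡ y × f k ≡ z → ¬ Q x y z
    go (_ , _ , _ , i<j , j<k , refl , refl , refl) = av i<j j<k

∣∣≥1⇒ : 1 ≤ ∣ S ∣ → Nonempty S
∣∣≥1⇒ {S = inside  Vec.∷ _} _ = zero , here
∣∣≥1⇒ {S = outside Vec.∷ _} h = let i , i∈ = ∣∣≥1⇒ h in suc i , there i∈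

∣∣≥2⇒ : 2 ≤ ∣ S ∣ → ∃[ i ] ∃[ j ] i Fin.< j × i ∈ₛ S × j ∈ₛ S
∣∣≥2⇒ {S = inside  Vec.∷ _} (s≤s h) = let j , j∈ = ∣∣≥1⇒ h in zero , suc j , s≤s z≤n , here , there j∈
∣∣≥2⇒ {S = outside Vec.∷ _} h =
  let i , j , i<j , i∈ , j∈ = ∣∣≥2⇒ h in suc i , suc j , s≤s i<j , there i∈ , there j∈

∣∣≥3⇒ : 3 ≤ ∣ S ∣ → ∃[ i ] ∃[ j ] ∃[ k ] i Fin.< j × j Fin.< k × i ∈ₛ S × j ∈ₛ S × k ∈ₛ S
∣∣≥3⇒ {S = inside  Vec.∷ _} (s≤s h) =
  let j , k , j<k , j∈ , k∈ = ∣∣≥2⇒ h in zero , suc j , suc k , s≤s z≤n , s≤s j<k , here , there j∈ , there k∈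
∣∣≥3⇒ {S = outside Vec.∷ _} h =
  let i , j , k , i<j , j<k , i∈ , j∈ , k∈ = ∣∣≥3⇒ h
  in suc i , suc j , suc k , s≤s i<j , s≤s j<k , there i∈ , there j∈ , there k∈

⇒∣∣≥1 : ∀ {i : Fin n} → i ∈ₛ S → 1 ≤ ∣ S ∣
⇒∣∣≥1 here = s≤s z≤n
⇒∣∣≥1 {S = inside  Vec.∷ _} (there i∈) = s≤s z≤n
⇒∣∣≥1 {S = outside Vec.∷ _} (there i∈) = ⇒∣∣≥1 i∈

⇒∣∣≥2 : ∀ {i j : Fin n} → i Fin.< j → i ∈ₛ S → j ∈ₛ S → 2 ≤ ∣ S ∣
⇒∣∣≥2 _ here (there j∈) = s≤s (⇒∣∣≥1 j∈)
⇒∣∣≥2 {S = inside  Vec.∷ _} (s≤s i<j) (there i∈) (there j∈) = s≤s (⇒∣∣≥1 i∈)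
⇒∣∣≥2 {S = outside Vec.∷ _} (s≤s i<j) (there i∈) (there j∈) = ⇒∣∣≥2 i<j i∈ j∈

⇒∣∣≥3 : ∀ {i j k : Fin n} → i Fin.< j → j Fin.< k → i ∈ₛ S → j ∈ₛ S → k ∈ₛ S → 3 ≤ ∣ S ∣
⇒∣∣≥3 _ (s≤s j<k) here (there j∈) (there k∈) = s≤s (⇒∣∣≥2 j<k j∈ k∈)
⇒∣∣≥3 {S = inside  Vec.∷ _} (s≤s i<j) (s≤s j<k) (there i∈) (there j∈) (there k∈) = s≤s (⇒∣∣≥2 j<k j∈ k∈)
⇒∣∣≥3 {S = outside Vec.∷ _} (s≤s i<j) (s≤s j<k) (there i∈) (there j∈) (there k∈) = ⇒∣∣≥3 i<j j<k i∈ j∈ k∈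

R1/2/3≐ : R n π1/2/3 ≐ AtMostTwoBlocks
R1/2/3≐ {n} = (λ {σ} → to σ) , λ {σ} → from σ
  where
  to : ∀ (σ : Π n) → R n π1/2/3 σ → AtMostTwoBlocks σ
  to σ σ∈R = ≮⇒≥ λ 2<l →
    let k , fk≡3       = surjective (s≤s z≤n) 2<l
        j , j<k , fj≡2 = predecessor k {2} (s≤s z≤n) (≤-reflexive (sym fk≡3))
        i , i<j , fi≡1 = predecessor j {1} (s≤s z≤n) (≤-reflexive (sym fj≡2))
    in R⇒avoidsAt {π = π1/2/3} refl S123-char σ σ∈R i<j j<k
         (≤-reflexive (trans (cong suc fi≡1) (sym fj≡2)) , ≤-reflexive (trans (cong suc fj≡2) (sym fk≡3)))
    where open Blocks σ
  from : ∀ (σ : Π n) → AtMostTwoBlocks σ → R n π1/2/3 σ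
  from σ l≤2 = avoidsAt⇒R {π = π1/2/3} refl S123-char σ λ {i} {j} {k} _ _ (fi<fj , fj<fk) →
    <⇒≱ (≤-<-trans (≤-<-trans (f-positive i) fi<fj) fj<fk) (≤-trans (f-≤length k) l≤2)
    where open Blocks σ

R123≐ : R n π123 ≐ Matching
R123≐ {n} = (λ {σ} → to σ) , λ {σ} → from σ
  where
  to : ∀ (σ : Π n) → R n π123 σ → Matching σ
  to σ σ∈R = All.tabulate λ S∈ → ≮⇒≥ λ 2<∣S∣ →
    let i , j , k , i<j , j<k , i∈ , j∈ , k∈ = ∣∣≥3⇒ 2<∣S∣
        _ , p = ∈⇒Nth S∈
    in R⇒avoidsAt {π = π123} refl S111-char σ σ∈R i<j j<k
         (trans (∈⇒f≡ p i∈) (sym (∈⇒f≡ p j∈)) , trans (∈⇒f≡ p j∈) (sym (∈⇒f≡ p k∈)))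
    where open Blocks σ
  from : ∀ (σ : Π n) → Matching σ → R n π123 σ
  from σ matching = avoidsAt⇒R {π = π123} refl S111-char σ λ {i} {j} {k} i<j j<k (fi≡fj , fj≡fk) →
    let S , p , i∈ = block i
    in <⇒≱ (⇒∣∣≥3 i<j j<k i∈ (f≡⇒∈ p (sym fi≡fj)) (f≡⇒∈ p (sym (trans fi≡fj fj≡fk)))) (All.lookup matching (Nth⇒∈ p))
    where open Blocks σ

∈-drop-1⁻ : ∀ {A : Set} {xs} {x : A} → x ∈ drop 1 xs → ∃[ v ] 2 ≤ v × Nth xs v x
∈-drop-1⁻ {xs = _ ∷ _} x∈ = let v , p = ∈⇒Nth x∈ in suc v , s≤s (Nth-positive p) , there p

∈-drop-1⁺ : ∀ {A : Set} {xs} {x : A} → 2 ≤ v → Nth xs v x → x ∈ drop 1 xs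
∈-drop-1⁺ (s≤s ()) here
∈-drop-1⁺ _ (there p) = Nth⇒∈ p

R1/23≐ : R n π1/23 ≐ SingletonsAfterFirst
R1/23≐ {n} = (λ {σ} → to σ) , λ {σ} → from σ
  where
  to : ∀ (σ : Π n) → R n π1/23 σ → SingletonsAfterFirst σ
  to σ σ∈R = All.tabulate λ S∈ →
    let v , 2≤v , p = ∈-drop-1⁻ S∈
        _ , _ , x∈  = element p
    in ≤-antisym (≮⇒≥ λ 1<∣S∣ →
         let j , k , j<k , j∈ , k∈ = ∣∣≥2⇒ 1<∣S∣
             1<fj = subst (2 ≤_) (sym (∈⇒f≡ p j∈)) 2≤v
             -- A value v of at least 2 is preceded by a 1, so its repetition completes 1 v v.
             i , i<j , fi≡1 = predecessor j {1} (s≤s z≤n) 1<fj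
         in R⇒avoidsAt {π = π1/23} refl S122-char σ σ∈R i<j j<k
              (subst (_< f j) (sym fi≡1) 1<fj , trans (∈⇒f≡ p j∈) (sym (∈⇒f≡ p k∈))))
       (⇒∣∣≥1 x∈)
    where open Blocks σ
  from : ∀ (σ : Π n) → SingletonsAfterFirst σ → R n π1/23 σ
  from σ single = avoidsAt⇒R {π = π1/23} refl S122-char σ λ {i} {j} {k} i<j j<k (fi<fj , fj≡fk) →
    let S , p , j∈ = block j
    in <⇒≱ (⇒∣∣≥2 j<k j∈ (f≡⇒∈ p (sym fj≡fk)))
         (≤-reflexive (All.lookup single (∈-drop-1⁺ (≤-<-trans (f-positive i) fi<fj) p)))
    where open Blocks σ

-- Intervals and layered partitions

module _ {a b : ℕ} where
  private
    between? : (i : Fin n) → _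
    between? i = (a ≤? suc (toℕ i)) ×-dec (suc (toℕ i) ≤? b)

  ∈-interval⁺ : ∀ {i : Fin n} → a ≤ suc (toℕ i) → suc (toℕ i) ≤ b → i ∈ₛ [ a , b ]
  ∈-interval⁺ p q = ∈-comprehension⁺ between? (p , q)

  ∈-interval⁻ : ∀ {i : Fin n} → i ∈ₛ [ a , b ] → a ≤ suc (toℕ i) × suc (toℕ i) ≤ b
  ∈-interval⁻ = ∈-comprehension⁻ between?

Convex : Subset n → Set
Convex S = ∀ {i j k} → i Fin.< j → j Fin.< k → i ∈ₛ S → k ∈ₛ S → j ∈ₛ S

interval⇒convex : Interval S → Convex S
interval⇒convex (a , b , refl) i<j j<k i∈ k∈ = ∈-interval⁺
  (≤-trans (proj₁ (∈-interval⁻ {a} {b} i∈)) (s≤s (<⇒≤ i<j)))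
  (≤-trans (s≤s (<⇒≤ j<k)) (proj₂ (∈-interval⁻ {a} {b} k∈)))

maximum : Nonempty S → ∃[ i ] i ∈ₛ S × (∀ {j} → j ∈ₛ S → j Fin.≤ i)
maximum {S = _ Vec.∷ S} ne with nonempty? S
... | yes ne′ = let i , i∈ , max = maximum ne′ in suc i , there i∈ , λ { here → z≤n ; (there j∈) → s≤s (max j∈) }
maximum {S = _ Vec.∷ S} (zero , here)      | no empty = zero , here , λ
  { here → z≤n ; (there j∈) → contradiction (_ , j∈) empty }
maximum {S = _ Vec.∷ S} (suc i , there i∈) | no empty = contradiction (i , i∈) empty

convex⇒interval : Nonempty S → Convex S → Interval S
convex⇒interval {S = S} ne convex with min-attained ne | maximum ne
... | i , i∈ , min≡ | k , k∈ , max = suc (toℕ i) , suc (toℕ k) , ⊆-antisym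
  (λ x∈ → ∈-interval⁺ (subst (_≤ _) min≡ (min-≤ x∈)) (s≤s (max x∈)))
  (λ x∈ → let i≤x , x≤k = ∈-interval⁻ x∈ in fill (m≤n⇒m<n∨m≡n (s≤s⁻¹ i≤x)) (m≤n⇒m<n∨m≡n (s≤s⁻¹ x≤k)))
  where
  fill : ∀ {x} → toℕ i < toℕ x ⊎ toℕ i ≡ toℕ x → toℕ x < toℕ k ⊎ toℕ x ≡ toℕ k → x ∈ₛ S
  fill (inj₁ i<x) (inj₁ x<k) = convex i<x x<k i∈ k∈
  fill (inj₂ i≡x) _          = subst (_∈ₛ S) (toℕ-injective i≡x) i∈
  fill _          (inj₂ x≡k) = subst (_∈ₛ S) (sym (toℕ-injective x≡k)) k∈

R13/2≐ : R n π13/2 ≐ LayeredΠ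
R13/2≐ {n} = (λ {σ} → to σ) , λ {σ} → from σ
  where
  to : ∀ (σ : Π n) → R n π13/2 σ → LayeredΠ σ
  to σ σ∈R = All.tabulate λ {S} S∈ →
    let v , p = ∈⇒Nth S∈ ; x , _ , x∈ = element p in convex⇒interval (x , x∈) (convex p)
    where
    open Blocks σ
    avoid : AvoidsAt S121 f
    avoid = R⇒avoidsAt {π = π13/2} refl S121-char σ σ∈R
    convex : ∀ {v S} → Nth Bs v S → Convex S
    convex p {i} {j} {k} i<j j<k i∈ k∈ with ∈⇒f≡ p i∈ | <-cmp (f j) (f i)
    ... | refl | tri≈ _ fj≡fi _ = f≡⇒∈ p fj≡fi
    ... | refl | tri> _ _ fi<fj = contradiction (sym (∈⇒f≡ p k∈) , fi<fj) (avoid i<j j<k)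
    -- A drop returns to an old value: `f j` has occurred at some h before i, so h, i, j form a 121.
    ... | refl | tri< fj<fi _ _ with predecessor i (f-positive j) fj<fi
    ...   | h , h<i , fh≡fj = contradiction (fh≡fj , subst (_< f i) (sym fh≡fj) fj<fi) (avoid h<i i<j)
  from : ∀ (σ : Π n) → LayeredΠ σ → R n π13/2 σ
  from σ layered = avoidsAt⇒R {π = π13/2} refl S121-char σ λ {i} {j} {k} i<j j<k (fi≡fk , fi<fj) →
    let S , p , i∈ = block i
        j∈ = interval⇒convex (All.lookup layered (Nth⇒∈ p)) i<j j<k i∈ (f≡⇒∈ p (sym fi≡fk))
    in <-irrefl (sym (∈⇒f≡ p j∈)) fi<fj
    where open Blocks σ

-- Singletons followed by descending layers

∈-singletons⁺ : ∀ {T : Subset n} {x} → x ∈ₛ T → ⁅ x ⁆ ∈ blocks (singletons T)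
∈-singletons⁺ {T = T} {x} x∈ = ∈-map⁺ ⁅_⁆ (∈-filter⁺ (_∈ₛ? T) (∈-allFin x) x∈)

∈-singletons⁻ : ∀ {T : Subset n} → D ∈ blocks (singletons T) → ∃[ x ] x ∈ₛ T × D ≡ ⁅ x ⁆
∈-singletons⁻ {n} {T = T} D∈ with ∈-map⁻ ⁅_⁆ D∈
... | x , x∈ , refl = x , proj₂ (∈-filter⁻ (_∈ₛ? T) {xs = allFin n} x∈) , refl

module _ (σ : Π n) (T : Subset n) where

  ∈-↾⁺ : S ∈ blocksΠ σ → Nonempty (S ∩ T) → S ∩ T ∈ blocks (σ ↾ T)
  ∈-↾⁺ S∈ ne = ∈-filter⁺ nonempty? (∈-map⁺ (_∩ T) S∈) ne

  ∈-↾⁻ : D ∈ blocks (σ ↾ T) → ∃[ S ] S ∈ blocksΠ σ × D ≡ S ∩ T × Nonempty D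
  ∈-↾⁻ D∈ with ∈-filter⁻ nonempty? {xs = map (_∩ T) (blocksΠ σ)} D∈
  ... | D∈map , ne with ∈-map⁻ (_∩ T) D∈map
  ... | S , S∈ , eq = S , S∈ , eq , ne

AllPairs-lookup : ∀ {A : Set} {R : A → A → Set} {xs x y} → AllPairs R xs → x ∈ xs → y ∈ xs → x ≡ y ⊎ R x y ⊎ R y x
AllPairs-lookup (_ ∷ _) (here refl) (here refl) = inj₁ refl
AllPairs-lookup (r ∷ _) (here refl) (there y∈)  = inj₂ (inj₁ (All.lookup r y∈))
AllPairs-lookup (r ∷ _) (there x∈)  (here refl) = inj₂ (inj₂ (All.lookup r x∈))
AllPairs-lookup (_ ∷ r) (there x∈)  (there y∈)  = AllPairs-lookup r x∈ y∈

-- The word is 1 2 … l followed by a weakly decreasing word, where l is the number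
-- of blocks: a repeat at a position i < l would precede the first occurrence of
-- suc i, giving a 112.  So l serves as the k of the characterisation.
module Avoids112 (σ : Π n) (avoid : AvoidsAt S112 (Blocks.f σ)) where
  open Blocks σ

  #blocks : ℕ
  #blocks = length Bs

  repeat-≥ : ∀ {i j k} → i Fin.< j → j Fin.< k → f i ≡ f j → f k ≤ f j
  repeat-≥ i<j j<k fi≡fj = ≮⇒≥ λ fj<fk → avoid i<j j<k (fi≡fj , fj<fk)

  -- The bound b turns this into strong induction on the position. Positions count from 0 and values
  -- from 1, hence `suc (toℕ i)`.
  prefix-below : ∀ b {i} → toℕ i < b → toℕ i < #blocks → f i ≡ suc (toℕ i)
  prefix-below (suc b) {i} (s≤s i≤b) i<l with <-cmp (f i) (suc (toℕ i))
  ... | tri≈ _ eq _ = eq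
  -- The value `suc (toℕ i)` would stand at an earlier j, where by induction the value is
  -- `suc (toℕ j)`.
  ... | tri> _ _ si<fi = let j , j<i , fj≡ = predecessor i (s≤s z≤n) si<fi
                             fj≡sj = prefix-below b (<-≤-trans j<i i≤b) (<-trans j<i i<l)
                         in contradiction j<i (<-irrefl (suc-injective (trans (sym fj≡sj) fj≡)))
  ... | tri< fi<si _ _ = late (f i) refl (f-positive i) fi<si
    where
    late : ∀ v → f i ≡ v → 1 ≤ v → v < suc (toℕ i) → f i ≡ suc (toℕ i)
    -- By induction position t has the value `suc t`, which i repeats. A position p with value
    -- `suc (toℕ i)` cannot lie before i by induction, nor after i, since t, i, p would form a 112.
    late (suc t) fi≡st _ (s≤s t<i) with surjective {suc (toℕ i)} (s≤s z≤n) i<l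
    ... | p , fp≡ with <-cmp (toℕ p) (toℕ i)
    ... | tri< p<i _ _ = contradiction p<i (<-irrefl (suc-injective (trans
      (sym (prefix-below b (<-≤-trans p<i i≤b) (<-trans p<i i<l))) fp≡)))
    ... | tri≈ _ p≡i _ = trans (cong f (sym (toℕ-injective p≡i))) fp≡
    ... | tri> _ _ i<p = contradiction (repeat-≥ j<i i<p (trans fj≡ (sym fi≡st))) (<⇒≱ (subst (f i <_) (sym fp≡) fi<si))
      where
      t<n : t < n
      t<n = <-trans t<i (toℕ<n i)
      j : Fin n
      j = fromℕ< t<n
      j<i : j Fin.< i
      j<i = subst (_< toℕ i) (sym (toℕ-fromℕ< t<n)) t<i
      fj≡ : f j ≡ suc t
      fj≡ = trans (prefix-below b (<-≤-trans j<i i≤b) (<-trans j<i i<l)) (cong suc (toℕ-fromℕ< t<n))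

  prefix : ∀ {i} → toℕ i < #blocks → f i ≡ suc (toℕ i)
  prefix {i} = prefix-below (suc (toℕ i)) ≤-refl

  -- All values occur among the first l positions, where l is the number of blocks. A later i
  -- therefore repeats one of them, and nothing after it may be larger.
  suffix : ∀ {i k} → #blocks ≤ toℕ i → i Fin.< k → f k ≤ f i
  suffix {i} {k} l≤i i<k = earlier (f i) refl (f-positive i) (f-≤length i)
    where
    earlier : ∀ v → f i ≡ v → 1 ≤ v → v ≤ #blocks → f k ≤ f i
    earlier (suc t) fi≡ _ t<l = repeat-≥ (<-≤-trans j<l l≤i) i<k
      (trans (prefix j<l) (trans (cong suc (toℕ-fromℕ< t<n)) (sym fi≡)))
      where
      t<n : t < n
      t<n = <-trans (<-≤-trans t<l l≤i) (toℕ<n i)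
      j : Fin n
      j = fromℕ< t<n
      j<l : toℕ j < #blocks
      j<l = subst (_< #blocks) (sym (toℕ-fromℕ< t<n)) t<l

  -- With more than n blocks, `prefix` would bound every value by n, yet the index of the last block
  -- is attained.
  #blocks≤n : #blocks ≤ n
  #blocks≤n = ≮⇒≥ λ n<l →
    let i , fi≡ = surjective (≤-trans (s≤s z≤n) n<l) ≤-refl
    in <-irrefl (trans (sym (prefix (<-trans (toℕ<n i) n<l))) fi≡) (≤-<-trans (toℕ<n i) n<l)

  T₁ T₂ : Subset n
  T₁ = [ 1 , #blocks ]
  T₂ = [ suc #blocks , n ]

  S∩T₁ : ∀ {v S x} → Nth Bs v S → x ∈ₛ S → x ∈ₛ T₁ → S ∩ T₁ ≡ ⁅ x ⁆
  S∩T₁ {S = S} {x} p x∈S x∈T = ⊆-antisym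
    (λ {y} y∈ → let y∈S , y∈T = x∈p∩q⁻ S T₁ y∈ in subst (_∈ₛ ⁅ x ⁆) (sym (same y∈S y∈T)) (x∈⁅x⁆ x))
    (λ y∈ → subst (_∈ₛ S ∩ T₁) (sym (x∈⁅y⁆⇒x≡y x y∈)) (x∈p∩q⁺ (x∈S , x∈T)))
    where
    f-on : ∀ {y} → y ∈ₛ T₁ → f y ≡ suc (toℕ y)
    f-on y∈T = prefix (proj₂ (∈-interval⁻ {1} {#blocks} y∈T))
    same : ∀ {y} → y ∈ₛ S → y ∈ₛ T₁ → y ≡ x
    same y∈S y∈T = toℕ-injective (suc-injective
      (trans (sym (f-on y∈T)) (trans (trans (∈⇒f≡ p y∈S) (sym (∈⇒f≡ p x∈S))) (f-on x∈T))))

  prefix-singletons : (σ ↾ T₁) ≋ singletons T₁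
  prefix-singletons = mk⇔ fwd bwd
    where
    fwd : ∀ {D} → D ∈ blocks (σ ↾ T₁) → D ∈ blocks (singletons T₁)
    fwd D∈ with ∈-↾⁻ σ T₁ D∈
    ... | S , S∈ , refl , x , x∈ =
      let x∈S , x∈T = x∈p∩q⁻ S T₁ x∈
      in subst (_∈ blocks (singletons T₁)) (sym (S∩T₁ (proj₂ (∈⇒Nth S∈)) x∈S x∈T)) (∈-singletons⁺ x∈T)
    bwd : ∀ {D} → D ∈ blocks (singletons T₁) → D ∈ blocks (σ ↾ T₁)
    bwd D∈ with ∈-singletons⁻ D∈
    ... | x , x∈T , refl =
      let S , p , x∈S = block x
      in subst (_∈ blocks (σ ↾ T₁)) (S∩T₁ p x∈S x∈T) (∈-↾⁺ σ T₁ (Nth⇒∈ p) (x , x∈p∩q⁺ (x∈S , x∈T)))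

  ∈T₂⇒ : ∀ {x} → x ∈ₛ T₂ → #blocks ≤ toℕ x
  ∈T₂⇒ = s≤s⁻¹ ∘ proj₁ ∘ ∈-interval⁻ {suc #blocks} {n}

  -- A weakly decreasing function that agrees at i and k is constant in between.
  suffix-layered : Layered (σ ↾ T₂)
  suffix-layered = All.tabulate λ D∈ → layer (∈-↾⁻ σ T₂ D∈)
    where
    layer : ∀ {D} → ∃[ S ] S ∈ Bs × D ≡ S ∩ T₂ × Nonempty D → Interval D
    layer (S , S∈ , refl , ne) = convex⇒interval ne λ {i} {j} {k} i<j j<k i∈ k∈ →
      let i∈S , i∈T = x∈p∩q⁻ S T₂ i∈ ; k∈S , k∈T = x∈p∩q⁻ S T₂ k∈ ; _ , p = ∈⇒Nth S∈
          l≤j = ≤-trans (∈T₂⇒ i∈T) (<⇒≤ i<j)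
      in x∈p∩q⁺ ( f≡⇒∈ p (≤-antisym (≤-trans (suffix (∈T₂⇒ i∈T) i<j) (≤-reflexive (∈⇒f≡ p i∈S)))
                                    (≤-trans (≤-reflexive (sym (∈⇒f≡ p k∈S))) (suffix l≤j j<k)))
                , ∈-interval⁺ (s≤s l≤j) (toℕ<n j))

  layer : ℕ → Subset n
  layer v = level f (suc v) ∩ T₂

  -- Among the last n - l positions smaller values stand further right, so listing
  -- the blocks from the last one down is listing them from left to right.
  layers : List (Subset n)
  layers = filter nonempty? (applyDownFrom layer #blocks)

  layers∼ : layers ∼[ set ] blocks (σ ↾ T₂)
  layers∼ = mk⇔ fwd bwd
    where
    fwd : ∀ {D} → D ∈ layers → D ∈ blocks (σ ↾ T₂)
    fwd D∈ with ∈-filter⁻ nonempty? {xs = applyDownFrom layer #blocks} D∈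
    ... | D∈′ , ne with ∈-applyDownFrom⁻ layer D∈′
    ... | v , v<l , refl with Nth-total Bs {suc v} (s≤s z≤n) v<l
    ... | S , p with Nth⇒level σ p
    ... | refl = ∈-↾⁺ σ T₂ (Nth⇒∈ p) ne
    bwd : ∀ {D} → D ∈ blocks (σ ↾ T₂) → D ∈ layers
    bwd D∈ with ∈-↾⁻ σ T₂ D∈
    ... | S , S∈ , refl , ne with ∈⇒Nth S∈
    ... | zero , p = contradiction (Nth-positive p) λ ()
    ... | suc v , p with Nth⇒level σ p
    ... | refl = ∈-filter⁺ nonempty? (∈-applyDownFrom⁺ layer (Nth-≤length p)) ne

  layers-descend : AllPairs (λ D E → D leftOf E × B σ D > B σ E) layers
  -- An empty layer is contained in the first block and would get index 1, so only nonempty layers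
  -- are compared.
  layers-descend = AllPairs-under (Allₚ.all-filter nonempty? (applyDownFrom layer #blocks))
    (AllPairsₚ.filter⁺ nonempty? (AllPairsₚ.applyDownFrom⁺₁ layer #blocks λ u<v v<l ne-v ne-u →
      (λ i∈ j∈ → left u<v i∈ j∈) ,
      subst₂ _<_ (sym (B-layer (<-trans u<v v<l) ne-u)) (sym (B-layer v<l ne-v)) (s≤s u<v)))
    where
    f-layer : ∀ {v i} → i ∈ₛ layer v → f i ≡ suc v × #blocks ≤ toℕ i
    f-layer {v} i∈ = let i∈L , i∈T = x∈p∩q⁻ (level f (suc v)) T₂ i∈ in ∈-comprehension⁻ (λ i → f i ≟ suc v) i∈L , ∈T₂⇒ i∈T
    left : ∀ {u v} → u < v → layer v leftOf layer u
    left u<v i∈ j∈ = let fi≡ , l≤i = f-layer i∈ ; fj≡ , l≤j = f-layer j∈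
                         fj<fi = subst₂ _<_ (sym fj≡) (sym fi≡) (s≤s u<v)
                     in ≰⇒> λ j≤i → apart fj<fi l≤j (m≤n⇒m<n∨m≡n j≤i)
      where
      apart : ∀ {i j} → f j < f i → #blocks ≤ toℕ j → ¬ (toℕ j < toℕ i ⊎ toℕ j ≡ toℕ i)
      apart fj<fi l≤j (inj₁ j<i) = <⇒≱ fj<fi (suffix l≤j j<i)
      apart fj<fi l≤j (inj₂ j≡i) = <-irrefl (cong f (toℕ-injective j≡i)) fj<fi
    B-layer : ∀ {v} → v < #blocks → Nonempty (layer v) → B σ (layer v) ≡ suc v
    B-layer {v} v<l ne with Nth-total Bs {suc v} (s≤s z≤n) v<l
    ... | S , p = B-block (subst (Nth Bs (suc v)) (Nth⇒level σ p) p) (p∩q⊆p (level f (suc v)) T₂) ne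

R12/3≐ : R n π12/3 ≐ SingletonsThenDescendingLayers
R12/3≐ {n} = (λ {σ} → to σ) , λ {σ} → from σ
  where
  to : ∀ (σ : Π n) → R n π12/3 σ → SingletonsThenDescendingLayers σ
  to σ σ∈R = #blocks , #blocks≤n , prefix-singletons , suffix-layered , layers , layers∼
           , AllPairs.map (λ r {i} {j} → proj₁ r {i} {j}) layers-descend , AllPairs.map proj₂ layers-descend
    where open Avoids112 σ (R⇒avoidsAt {π = π12/3} refl S112-char σ σ∈R)
  from : ∀ (σ : Π n) → SingletonsThenDescendingLayers σ → R n π12/3 σ
  from σ (k , _ , single , _ , Ds , Ds∼ , left , descend) = avoidsAt⇒R {π = π12/3} refl S112-char σ avoid
    where
    open Blocks σ
    T₁ T₂ : Subset n
    T₁ = [ 1 , k ]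
    T₂ = [ suc k , n ]

    distinct : ∀ {i j} → i ∈ₛ T₁ → j ∈ₛ T₁ → f i ≡ f j → i ≡ j
    distinct {i} {j} i∈T j∈T fi≡fj with block i
    ... | S , p , i∈S with ∈-singletons⁻ (Equivalence.to single (∈-↾⁺ σ T₁ (Nth⇒∈ p) (i , x∈p∩q⁺ (i∈S , i∈T))))
    ... | x , _ , eq = trans (is-x (x∈p∩q⁺ (i∈S , i∈T))) (sym (is-x (x∈p∩q⁺ (f≡⇒∈ p (sym fi≡fj) , j∈T))))
      where
      is-x : ∀ {y} → y ∈ₛ S ∩ T₁ → y ≡ x
      is-x y∈ = x∈⁅y⁆⇒x≡y x (subst (_ ∈ₛ_) eq y∈)

    decreasing : ∀ {i j} → i Fin.< j → i ∈ₛ T₂ → j ∈ₛ T₂ → ¬ (f i < f j)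
    decreasing {i} {j} i<j i∈T j∈T fi<fj with block i | block j
    -- Equal traces on `T₂` give equal values. If the trace of S is listed first, its index is
    -- larger; if that of D is, then j precedes i. Each case is a contradiction.
    ... | S , p , i∈S | D , q , j∈D = compare (AllPairs-lookup (AllPairs.zip (left , descend)) (∈Ds p i∈S∩T) (∈Ds q j∈D∩T))
      where
      i∈S∩T = x∈p∩q⁺ (i∈S , i∈T)
      j∈D∩T = x∈p∩q⁺ (j∈D , j∈T)
      ∈Ds : ∀ {v E x} → Nth Bs v E → x ∈ₛ E ∩ T₂ → E ∩ T₂ ∈ Ds
      ∈Ds r x∈ = Equivalence.from Ds∼ (∈-↾⁺ σ T₂ (Nth⇒∈ r) (_ , x∈))
      B-S : B σ (S ∩ T₂) ≡ f i
      B-S = B-block p (p∩q⊆p S T₂) (i , i∈S∩T)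
      B-D : B σ (D ∩ T₂) ≡ f j
      B-D = B-block q (p∩q⊆p D T₂) (j , j∈D∩T)
      compare : ¬ (S ∩ T₂ ≡ D ∩ T₂ ⊎ (_ × B σ (S ∩ T₂) > B σ (D ∩ T₂)) ⊎ ((D ∩ T₂) leftOf (S ∩ T₂)) × _)
      compare (inj₁ eq)             = <-irrefl (trans (sym B-S) (trans (cong (B σ) eq) B-D)) fi<fj
      compare (inj₂ (inj₁ (_ , gt))) = <⇒≱ fi<fj (<⇒≤ (subst (f j <_) B-S (subst (_< B σ (S ∩ T₂)) B-D gt)))
      compare (inj₂ (inj₂ (lt , _))) = <⇒≱ i<j (<⇒≤ (lt j∈D∩T i∈S∩T))

    avoid : AvoidsAt S112 f
    -- For j among the first k positions, i and j would share a singleton; otherwise j and h both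
    -- lie in `T₂`, where values cannot rise.
    avoid {i} {j} {h} i<j j<h (fi≡fj , fj<fh) with suc (toℕ j) ≤? k
    ... | yes j≤k = <-irrefl (cong toℕ (distinct
      (∈-interval⁺ (s≤s z≤n) (≤-trans (<⇒≤ (s≤s i<j)) j≤k)) (∈-interval⁺ (s≤s z≤n) j≤k) fi≡fj)) i<j
    ... | no j≰k  = decreasing j<h (∈-interval⁺ (≰⇒> j≰k) (toℕ<n j))
                      (∈-interval⁺ (≤-trans (≰⇒> j≰k) (s≤s (<⇒≤ j<h))) (toℕ<n h)) fj<fh

theorem4p3 : (n : ℕ) → 1 ≤ n →
    (R n π1/2/3 ≐ AtMostTwoBlocks × # (R n π1/2/3) is (2 ^ (n ∸ 1)))
    × (R n π123 ≐ Matching × # (R n π123) is sum (map (λ i → (n C (2 * i)) * [2 i ]!!) (upTo (suc n))))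
    × (R n π12/3 ≐ SingletonsThenDescendingLayers × # (R n π12/3) is (2 ^ (n ∸ 1)))
    × (R n π1/23 ≐ SingletonsAfterFirst × # (R n π1/23) is (2 ^ (n ∸ 1)))
    × (R n π13/2 ≐ LayeredΠ × # (R n π13/2) is (2 ^ (n ∸ 1)))
theorem4p3 (suc k) _ =
    (R1/2/3≐ , subst (# R (suc k) π1/2/3 is_) (Walks123.length-1∷walks k)
      (#R {π = π1/2/3} refl S123-char (Walks123.list123 k)))
  , (R123≐ , subst (# R (suc k) π123 is_) (length-words111-sum (suc k))
      (#R {π = π123} refl S111-char (list111 (suc k))))
  , (R12/3≐ , subst (# R (suc k) π12/3 is_) (length-words112 k)
      (#R {π = π12/3} refl S112-char (list112 k)))
  , (R1/23≐ , subst (# R (suc k) π1/23 is_) (Walks122.length-1∷walks k)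
      (#R {π = π1/23} refl S122-char (Walks122.list122 k)))
  , (R13/2≐ , subst (# R (suc k) π13/2 is_) (Walks121.length-1∷walks k)
      (#R {π = π13/2} refl S121-char (Walks121.list121 k)))
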